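{- For $n\ge 3$ let $C_n$ be the $n$-cycle (the connected graph with $n$ vertices all of degree $2$) and let $S_{C_n}$ denote the number of invertible Schr\"odinger operators of $C_n$ over $\mathbb F_q$, $q$ a prime power. If $q$ is odd then, for all $n\ge1$, $$S_{C_{2n+1}}=q^{2n+1}-\frac{1-q^{2n+2}}{1-q^2},\qquad S_{C_{4n}}=q^{4n}-q^{2n}+\frac{(1-q^{2n})(1-q^{2n+1})}{1-q^2},$$ $$S_{C_{4n+2}}=q^{4n+2}+\frac{(1-q^{2n+1})(1-q^{2n+2})}{1-q^2}.$$ If $q$ is even then $$S_{C_{2n+1}}=q^{2n+1}-\frac{1-q^{2n+2}}{1-q^2}\quad(n\ge1),\qquad S_{C_{2n}}=q^{2n}-q^{n}+\frac{(1-q^{n})(1-q^{n+1})}{1-q^2}\quad(n\ge2).$$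
   Context: A Schr\"odinger operator of a graph $G$ over a field $\mathbb F$ is a matrix $A+D$ where $A$ is the adjacency matrix of $G$ and $D$ is an arbitrary diagonal matrix over $\mathbb F$. The number of invertible Schr\"odinger operators over $\mathbb F_q$ is the number of diagonal matrices $D$ over $\mathbb F_q$ with $A+D$ invertible. -}

module Defs where

open import Data.Nat as ℕ using (ℕ; zero; suc; _≟_)
open import Data.Fin as Fin using (Fin; toℕ)
open import Data.Fin.Properties using () renaming (_≟_ to _≟ᶠ_)
open import Data.Vec using (Vec; []; _∷_; lookup)
open import Data.List using (List; []; _∷_; map; concatMap; filter; length)
open import Data.Sum using (_⊎_)
open import Data.Product using (Σ; _×_; _,_)
open import Relation.Nullary using (¬_; Dec; yes; no)
open import Relation.Unary using (Decidable)
open import Relation.Binary.PropositionalEquality using (_≡_)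
open import Algebra.Structures using (IsCommutativeRing)
open import Function.Bundles using (_↔_)
open import Function.Base using (_∘_)

record FiniteField (q : ℕ) : Set₁ where
  field
    Carrier   : Set
    _+_ _*_   : Carrier → Carrier → Carrier
    -_        : Carrier → Carrier
    0# 1#     : Carrier
    isCommutativeRing : IsCommutativeRing _≡_ _+_ _*_ -_ 0# 1#
    0≢1       : ¬ (0# ≡ 1#)
    inverse   : (x : Carrier) → ¬ (x ≡ 0#) → Σ Carrier (λ y → (x * y) ≡ 1#)
    _≟F_      : (x y : Carrier) → Dec (x ≡ y)
    enum      : Fin q ↔ Carrier

module _ {q : ℕ} (F : FiniteField q) where
  open FiniteField F
  open Function.Bundles.Inverse enum using (to)

  Matrix : ℕ → Set
  Matrix m = Fin m → Fin m → Carrier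

  sumF : ∀ {m} → (Fin m → Carrier) → Carrier
  sumF {zero}  f = 0#
  sumF {suc m} f = f Fin.zero + sumF (f ∘ Fin.suc)

  _⊗_ : ∀ {m} → Matrix m → Matrix m → Matrix m
  (M ⊗ N) i j = sumF (λ k → M i k * N k j)

  identity : ∀ {m} → Matrix m
  identity i j with i ≟ᶠ j
  ... | yes _ = 1#
  ... | no  _ = 0#

  Invertible : ∀ {m} → Matrix m → Set
  Invertible {m} M = Σ (Matrix m) λ N →
    (∀ i j → (M ⊗ N) i j ≡ identity i j) × (∀ i j → (N ⊗ M) i j ≡ identity i j)

  -- adjacency matrix of the cycle C_m on vertices 0,…,m-1 (i ~ i+1 mod m);
  -- used for m ≥ 3
  CycleEdge : (m : ℕ) → Fin m → Fin m → Set
  CycleEdge m i j = (toℕ j ≡ suc (toℕ i)) ⊎ (toℕ i ≡ suc (toℕ j))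
                  ⊎ ((suc (toℕ i) ≡ m) × (toℕ j ≡ 0))
                  ⊎ ((suc (toℕ j) ≡ m) × (toℕ i ≡ 0))

  cycleEdge? : (m : ℕ) (i j : Fin m) → Dec (CycleEdge m i j)
  cycleEdge? m i j =
    Relation.Nullary._⊎-dec_ (toℕ j ≟ suc (toℕ i))
      (Relation.Nullary._⊎-dec_ (toℕ i ≟ suc (toℕ j))
        (Relation.Nullary._⊎-dec_ (Relation.Nullary._×-dec_ (suc (toℕ i) ≟ m) (toℕ j ≟ 0))
                                  (Relation.Nullary._×-dec_ (suc (toℕ j) ≟ m) (toℕ i ≟ 0))))

  cycleAdj : (m : ℕ) → Matrix m
  cycleAdj m i j with cycleEdge? m i j
  ... | yes _ = 1#
  ... | no  _ = 0#

  schrodinger : ∀ {m} → Matrix m → Vec Carrier m → Matrix m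
  schrodinger A d i j with i ≟ᶠ j
  ... | yes _ = A i j + lookup d i
  ... | no  _ = A i j

  allElems : List Carrier
  allElems = map to (Data.List.allFin q)

  allVecs : (m : ℕ) → List (Vec Carrier m)
  allVecs zero    = [] ∷ []
  allVecs (suc m) = concatMap (λ x → map (x ∷_) (allVecs m)) allElems

  -- number of diagonal matrices D with A + D invertible;
  -- inv? is any decision procedure for invertibility (the count does not depend on it)
  numInvSchrodinger : (inv? : ∀ {m} (M : Matrix m) → Dec (Invertible M)) →
                      ∀ {m} → Matrix m → ℕ
  numInvSchrodinger inv? A = length (filter (λ d → inv? (schrodinger A d)) (allVecs _))

  S-cycle : (inv? : ∀ {m} (M : Matrix m) → Dec (Invertible M)) → ℕ → ℕ
  S-cycle inv? m = numInvSchrodinger inv? (cycleAdj m)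

{-# OPTIONS --safe #-}

-- A vector x is in the kernel of A + D exactly when xᵢ₋₁ = −(xᵢ₊₁ + dᵢ xᵢ) cyclically, so A + D is
-- invertible iff the transfer matrix T(d) ∈ SL₂(F), the product of the matrices of these steps, does not
-- have the eigenvalue 1, i.e. iff tr T(d) ≠ 2.  Let (β , δ) be the second column of T.  Prepending a letter
-- to a word w gives trace 2 for exactly one letter if δ(w) ≠ 0; if δ(w) = 0 it does so for all letters or
-- for none, according to whether β(w) = −1.  So only the words with δ = 0, and those with (β , δ) = (±1 , 0),
-- have to be counted, and these counts satisfy linear recurrences in the length.  The recurrence for
-- (±1 , 0) exchanges the two signs, which is why the answer depends on the length mod 4 unless 1 = −1 in F;
-- the latter happens iff q is even, by counting fixed points of x ↦ −x and x ↦ x + 1.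
module Submission where

open import Defs
open import Algebra.Bundles using (CommutativeRing)
import Algebra.Properties.AbelianGroup as AbelianGroupProperties
import Algebra.Properties.Ring as RingProperties
import Algebra.Properties.Semiring.Mult.TCOptimised as Mult
import Algebra.Properties.Semiring.Sum as Sum
import Algebra.Solver.Ring as Solver
open import Algebra.Solver.Ring.AlmostCommutativeRing using (fromCommutativeRing; _-Raw-AlmostCommutative⟶_)
open import Data.Fin as Fin using (Fin; zero; suc; toℕ; fromℕ; inject₁)
import Data.Fin.Permutation as Perm
import Data.Fin.Properties as Finₚ
open import Data.Fin.Relation.Unary.Top using (view; ‵fromℕ; ‵inject₁)
open import Data.Integer as ℤ using (ℤ)
import Data.Integer.Properties as ℤₚ
open import Data.Integer.Tactic.RingSolver using (solve-∀)
open import Data.List as List using (List; []; _∷_)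
import Data.List.Properties as Listₚ
open import Data.Maybe as Maybe using (Maybe)
open import Data.Nat using (_≥_; s≤s)
open import Data.Nat as ℕ using (ℕ; zero; suc)
open import Data.Nat.Divisibility using (_∣_; divides)
import Data.Nat.ListAction as ListAction
open import Data.Nat.ListAction.Properties using (sum-++)
import Data.Nat.Properties as ℕₚ
open import Data.Sum using (_⊎_; inj₁; inj₂; [_,_]′)
open import Data.Vec as Vec using (Vec; []; _∷_; lookup)
import Data.Vec.Properties as Vecₚ
open import Function using (_∘_; Inverse)
open import Level using (0ℓ)
open import Relation.Binary.Definitions using (tri<; tri≈; tri>)
import Relation.Binary.PropositionalEquality as ≡
open import Relation.Nullary using (¬_; Dec; yes; no; ¬?; _×-dec_; contradiction)
open import Relation.Nullary.Decidable using (dec⇒maybe)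
open import Relation.Unary using (Pred; Decidable)

-- Arithmetic of coefficients in an abstract ring is stuck, so the ring solver is run with integer ones.
module IntegerCoefficients {c ℓ} (R : CommutativeRing c ℓ) where
  open import Data.Integer using (+_; -[1+_])
  open CommutativeRing R
  open Mult semiring
  open RingProperties ring using (-‿distribˡ-*; -‿distribʳ-*)
  open AbelianGroupProperties +-abelianGroup using (⁻¹-involutive; ε⁻¹≈ε; ⁻¹-∙-comm; xyx⁻¹≈y)
  open import Relation.Binary.Reasoning.Setoid setoid

  ⟦_⟧ℤ : ℤ → Carrier
  ⟦ + n ⟧ℤ     = n × 1#
  ⟦ -[1+ n ] ⟧ℤ = - (suc n × 1#)

  -‿homo : ∀ i → ⟦ ℤ.- i ⟧ℤ ≈ - ⟦ i ⟧ℤ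
  -‿homo (+ zero)  = sym ε⁻¹≈ε
  -‿homo (+ suc n) = refl
  -‿homo -[1+ n ]  = sym (⁻¹-involutive _)

  -- Addition of integers of opposite sign computes through `⊖`, so both mixed cases of `+-homo`
  -- reduce to this.
  ⊖-homo : ∀ m n → ⟦ m ℤ.⊖ n ⟧ℤ ≈ m × 1# - n × 1#
  ⊖-homo m zero = begin
    ⟦ m ℤ.⊖ 0 ⟧ℤ  ≡⟨ ≡.cong ⟦_⟧ℤ (ℤₚ.⊖-≥ {m} ℕ.z≤n) ⟩
    m × 1#        ≈⟨ +-identityʳ _ ⟨
    m × 1# + 0#   ≈⟨ +-congˡ ε⁻¹≈ε ⟨
    m × 1# - 0#   ∎
  ⊖-homo zero (suc n) = sym (+-identityˡ _)
  ⊖-homo (suc m) (suc n) = begin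
    ⟦ suc m ℤ.⊖ suc n ⟧ℤ               ≡⟨ ≡.cong ⟦_⟧ℤ (ℤₚ.[1+m]⊖[1+n]≡m⊖n m n) ⟩
    ⟦ m ℤ.⊖ n ⟧ℤ                       ≈⟨ ⊖-homo m n ⟩
    m × 1# - n × 1#                    ≈⟨ +-congʳ (xyx⁻¹≈y 1# (m × 1#)) ⟨
    1# + m × 1# - 1# - n × 1#          ≈⟨ +-assoc _ _ _ ⟩
    1# + m × 1# + (- 1# - n × 1#)      ≈⟨ +-congˡ (⁻¹-∙-comm 1# (n × 1#)) ⟩
    1# + m × 1# - (1# + n × 1#)        ≈⟨ +-cong (1+× m 1#) (-‿cong (1+× n 1#)) ⟨
    suc m × 1# - suc n × 1#            ∎

  +-homo : ∀ i j → ⟦ i ℤ.+ j ⟧ℤ ≈ ⟦ i ⟧ℤ + ⟦ j ⟧ℤ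
  +-homo (+ m) (+ n)         = ×-homo-+ 1# m n
  +-homo (+ m) -[1+ n ]      = ⊖-homo m (suc n)
  +-homo -[1+ m ] (+ n)      = trans (⊖-homo n (suc m)) (+-comm _ _)
  +-homo -[1+ m ] -[1+ n ]   = begin
    - (suc (suc (m ℕ.+ n)) × 1#)      ≡⟨ ≡.cong (λ k → - (suc k × 1#)) (ℕₚ.+-suc m n) ⟨
    - ((suc m ℕ.+ suc n) × 1#)        ≈⟨ -‿cong (×-homo-+ 1# (suc m) (suc n)) ⟩
    - (suc m × 1# + suc n × 1#)       ≈⟨ ⁻¹-∙-comm _ _ ⟨
    - (suc m × 1#) - suc n × 1#       ∎

  +*+-homo : ∀ m n → ⟦ + m ℤ.* + n ⟧ℤ ≈ (m × 1#) * (n × 1#)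
  +*+-homo m n = begin
    ⟦ + m ℤ.* + n ⟧ℤ      ≡⟨ ≡.cong ⟦_⟧ℤ (ℤₚ.pos-* m n) ⟨
    (m ℕ.* n) × 1#        ≈⟨ ×1-homo-* m n ⟩
    (m × 1#) * (n × 1#)   ∎

  *-homo : ∀ i j → ⟦ i ℤ.* j ⟧ℤ ≈ ⟦ i ⟧ℤ * ⟦ j ⟧ℤ
  *-homo (+ m) (+ n) = +*+-homo m n
  *-homo (+ m) -[1+ n ] = begin
    ⟦ + m ℤ.* (ℤ.- + suc n) ⟧ℤ   ≡⟨ ≡.cong ⟦_⟧ℤ (ℤₚ.neg-distribʳ-* (+ m) (+ suc n)) ⟨
    ⟦ ℤ.- (+ m ℤ.* + suc n) ⟧ℤ   ≈⟨ -‿homo (+ m ℤ.* + suc n) ⟩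
    - ⟦ + m ℤ.* + suc n ⟧ℤ       ≈⟨ -‿cong (+*+-homo m (suc n)) ⟩
    - ((m × 1#) * (suc n × 1#))  ≈⟨ -‿distribʳ-* _ _ ⟩
    (m × 1#) * - (suc n × 1#)    ∎
  *-homo -[1+ m ] (+ n) = begin
    ⟦ (ℤ.- + suc m) ℤ.* + n ⟧ℤ   ≡⟨ ≡.cong ⟦_⟧ℤ (ℤₚ.neg-distribˡ-* (+ suc m) (+ n)) ⟨
    ⟦ ℤ.- (+ suc m ℤ.* + n) ⟧ℤ   ≈⟨ -‿homo (+ suc m ℤ.* + n) ⟩
    - ⟦ + suc m ℤ.* + n ⟧ℤ       ≈⟨ -‿cong (+*+-homo (suc m) n) ⟩
    - ((suc m × 1#) * (n × 1#))  ≈⟨ -‿distribˡ-* _ _ ⟩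
    - (suc m × 1#) * (n × 1#)    ∎
  *-homo -[1+ m ] -[1+ n ] = begin
    (suc m ℕ.* suc n) × 1#             ≈⟨ ×1-homo-* (suc m) (suc n) ⟩
    (suc m × 1#) * (suc n × 1#)        ≈⟨ ⁻¹-involutive _ ⟨
    - - ((suc m × 1#) * (suc n × 1#))  ≈⟨ -‿cong (-‿distribˡ-* _ _) ⟩
    - (- (suc m × 1#) * (suc n × 1#))  ≈⟨ -‿distribʳ-* _ _ ⟩
    - (suc m × 1#) * - (suc n × 1#)    ∎

  morphism : CommutativeRing.rawRing ℤₚ.+-*-commutativeRing -Raw-AlmostCommutative⟶ fromCommutativeRing R
  morphism = record
    { ⟦_⟧    = ⟦_⟧ℤ
    ; +-homo = +-homo
    ; *-homo = *-homo
    ; -‿homo = -‿homo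
    ; 0-homo = refl
    ; 1-homo = refl
    }

  _coeff≟_ : ∀ i j → Maybe (⟦ i ⟧ℤ ≈ ⟦ j ⟧ℤ)
  i coeff≟ j = Maybe.map (λ eq → reflexive (≡.cong ⟦_⟧ℤ eq)) (dec⇒maybe (i ℤ.≟ j))

  open Solver (CommutativeRing.rawRing ℤₚ.+-*-commutativeRing) (fromCommutativeRing R) morphism _coeff≟_ public
    using (solve; con; _:=_; _:+_; _:*_; _:-_; :-_)

open import Data.Product using (∃; _×_; _,_; proj₁; proj₂)
open ≡ using (_≡_; refl; sym; trans; cong; cong₂; subst; subst₂; module ≡-Reasoning)

-- Sums of indicators over finite sets.

module ∑ℕ = Sum ℕₚ.+-*-semiring
open ∑ℕ using (sum-syntax; sum-cong-≗; ∑-distrib-+; ∑-comm; ∑-permute; *-distribˡ-sum)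

ind : ∀ {p} {P : Set p} → Dec P → ℕ
ind (yes _) = 1
ind (no _)  = 0

ind-yes : ∀ {p} {P : Set p} (d : Dec P) → P → ind d ≡ 1
ind-yes (yes _) p = refl
ind-yes (no ¬p) p = contradiction p ¬p

ind-no : ∀ {p} {P : Set p} (d : Dec P) → ¬ P → ind d ≡ 0
ind-no (yes p) ¬p = contradiction p ¬p
ind-no (no _)  ¬p = refl

ind-cong : ∀ {p r} {P : Set p} {R : Set r} (d : Dec P) (e : Dec R) → (P → R) → (R → P) → ind d ≡ ind e
ind-cong (yes p) e f g = sym (ind-yes e (f p))
ind-cong (no ¬p) e f g = sym (ind-no e (¬p ∘ g))

ind-¬ : ∀ {p} {P : Set p} (d : Dec P) → ind d ℕ.+ ind (¬? d) ≡ 1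
ind-¬ (yes _) = refl
ind-¬ (no _)  = refl

∑-const : ∀ n c → ∑[ i < n ] c ≡ n ℕ.* c
∑-const zero    c = refl
∑-const (suc n) c = cong (c ℕ.+_) (∑-const n c)

∑-none : ∀ {p n} {P : Pred (Fin n) p} (P? : Decidable P) → (∀ i → ¬ P i) → ∑[ i < n ] ind (P? i) ≡ 0
∑-none {n = n} P? ¬P = trans (sum-cong-≗ (λ i → ind-no (P? i) (¬P i))) (trans (∑-const n 0) (ℕₚ.*-zeroʳ n))

∑-unique : ∀ {p n} {P : Pred (Fin n) p} (P? : Decidable P) i → P i → (∀ j → P j → j ≡ i) →
           ∑[ j < n ] ind (P? j) ≡ 1
∑-unique P? zero p uniq =
  cong₂ ℕ._+_ (ind-yes (P? zero) p) (∑-none (P? ∘ suc) λ j pj → contradiction (uniq (suc j) pj) λ ())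
∑-unique P? (suc i) p uniq =
  cong₂ ℕ._+_ (ind-no (P? zero) λ p0 → contradiction (uniq zero p0) λ ())
              (∑-unique (P? ∘ suc) i p λ j pj → Finₚ.suc-injective (uniq (suc j) pj))

-- The points moved up by an involution are in bijection with those moved down.
involution-parity : ∀ {n} (φ : Fin n → Fin n) → (∀ i → φ (φ i) ≡ i) →
                    ∃ λ k → n ≡ ∑[ i < n ] ind (φ i Finₚ.≟ i) ℕ.+ k ℕ.* 2
involution-parity {n} φ φφ = up , (begin
  n                                                     ≡⟨ ℕₚ.*-identityʳ n ⟨
  n ℕ.* 1                                               ≡⟨ ∑-const n 1 ⟨
  ∑[ i < n ] 1                                          ≡⟨ sum-cong-≗ trichotomy ⟩
  ∑[ i < n ] (fixed i ℕ.+ (i<φ i ℕ.+ φ<i i))            ≡⟨ ∑-distrib-+ fixed _ ⟩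
  ∑[ i < n ] fixed i ℕ.+ ∑[ i < n ] (i<φ i ℕ.+ φ<i i)   ≡⟨ cong (∑ℕ.sum fixed ℕ.+_) (∑-distrib-+ i<φ φ<i) ⟩
  ∑[ i < n ] fixed i ℕ.+ (up ℕ.+ ∑[ i < n ] φ<i i)      ≡⟨ cong (λ k → ∑ℕ.sum fixed ℕ.+ (up ℕ.+ k)) down≡up ⟩
  ∑[ i < n ] fixed i ℕ.+ (up ℕ.+ up)                    ≡⟨ cong (∑ℕ.sum fixed ℕ.+_) double ⟩
  ∑[ i < n ] fixed i ℕ.+ up ℕ.* 2                       ∎)
  where
  open ≡-Reasoning
  fixed i<φ φ<i : Fin n → ℕ
  fixed i = ind (φ i Finₚ.≟ i)
  i<φ i = ind (i Finₚ.<? φ i)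
  φ<i i = ind (φ i Finₚ.<? i)
  up : ℕ
  up = ∑[ i < n ] i<φ i
  trichotomy : ∀ i → 1 ≡ fixed i ℕ.+ (i<φ i ℕ.+ φ<i i)
  trichotomy i with Finₚ.<-cmp (φ i) i
  ... | tri< a ¬b ¬c = sym (cong₂ ℕ._+_ (ind-no (φ i Finₚ.≟ i) ¬b)
                         (cong₂ ℕ._+_ (ind-no (i Finₚ.<? φ i) ¬c) (ind-yes (φ i Finₚ.<? i) a)))
  ... | tri≈ ¬a b ¬c = sym (cong₂ ℕ._+_ (ind-yes (φ i Finₚ.≟ i) b)
                         (cong₂ ℕ._+_ (ind-no (i Finₚ.<? φ i) ¬c) (ind-no (φ i Finₚ.<? i) ¬a)))
  ... | tri> ¬a ¬b c = sym (cong₂ ℕ._+_ (ind-no (φ i Finₚ.≟ i) ¬b)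
                         (cong₂ ℕ._+_ (ind-yes (i Finₚ.<? φ i) c) (ind-no (φ i Finₚ.<? i) ¬a)))
  down≡up : ∑[ i < n ] φ<i i ≡ up
  down≡up = trans (∑-permute φ<i (Perm.permutation φ φ φφ φφ))
    (sum-cong-≗ λ i → ind-cong (φ (φ i) Finₚ.<? φ i) (i Finₚ.<? φ i)
      (subst (Fin._< φ i) (φφ i)) (subst (Fin._< φ i) (sym (φφ i))))
  double : up ℕ.+ up ≡ up ℕ.* 2
  double = trans (cong (up ℕ.+_) (sym (ℕₚ.+-identityʳ up))) (ℕₚ.*-comm 2 up)

-- Lengths of filtered lists as sums.

length-filter : ∀ {a p} {A : Set a} {P : Pred A p} (P? : Decidable P) xs →
                List.length (List.filter P? xs) ≡ ListAction.sum (List.map (ind ∘ P?) xs)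
length-filter P? [] = refl
length-filter P? (x ∷ xs) with P? x
... | yes _ = cong suc (length-filter P? xs)
... | no _  = length-filter P? xs

sum-map-concatMap : ∀ {a b} {A : Set a} {B : Set b} (f : B → ℕ) (g : A → List B) xs →
  ListAction.sum (List.map f (List.concatMap g xs)) ≡ ListAction.sum (List.map (λ x → ListAction.sum (List.map f (g x))) xs)
sum-map-concatMap f g [] = refl
sum-map-concatMap f g (x ∷ xs) = begin
  ListAction.sum (List.map f (g x List.++ List.concatMap g xs))                        ≡⟨ cong ListAction.sum (Listₚ.map-++ f (g x) _) ⟩
  ListAction.sum (List.map f (g x) List.++ List.map f (List.concatMap g xs))           ≡⟨ sum-++ (List.map f (g x)) _ ⟩
  ListAction.sum (List.map f (g x)) ℕ.+ ListAction.sum (List.map f (List.concatMap g xs))    ≡⟨ cong (ListAction.sum (List.map f (g x)) ℕ.+_) (sum-map-concatMap f g xs) ⟩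
  ListAction.sum (List.map f (g x)) ℕ.+ ListAction.sum (List.map (λ x → ListAction.sum (List.map f (g x))) xs) ∎
  where open ≡-Reasoning

sum-tabulate : ∀ {n} (f : Fin n → ℕ) → ListAction.sum (List.tabulate f) ≡ ∑[ i < n ] f i
sum-tabulate {zero}  f = refl
sum-tabulate {suc n} f = cong (f zero ℕ.+_) (sum-tabulate (f ∘ suc))

-- Counting elements of the field and words over it.

module Counting {q : ℕ} (F : FiniteField q) where
  open FiniteField F using (enum; _≟F_; inverse; 0≢1)
  open Inverse enum using (to; from; strictlyInverseˡ; strictlyInverseʳ)

  ringF : CommutativeRing 0ℓ 0ℓ
  ringF = record { isCommutativeRing = FiniteField.isCommutativeRing F }

  open CommutativeRing ringF hiding (refl; sym; trans; setoid; zero)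
  open IntegerCoefficients ringF using (solve; con; _:=_; _:+_; _:*_; _:-_; :-_)

  *-cancel-0 : ∀ x {y} → ¬ x ≡ 0# → x * y ≡ 0# → y ≡ 0#
  *-cancel-0 x {y} x≢0 xy≡0 = begin
    y              ≡⟨ *-identityʳ y ⟨
    y * 1#         ≡⟨ cong (y *_) xx⁻¹≡1 ⟨
    y * (x * x⁻¹)  ≡⟨ solve 3 (λ y x z → y :* (x :* z) := (x :* y) :* z) refl y x x⁻¹ ⟩
    (x * y) * x⁻¹  ≡⟨ cong (_* x⁻¹) xy≡0 ⟩
    0# * x⁻¹       ≡⟨ zeroˡ x⁻¹ ⟩
    0#             ∎
    where
    open ≡-Reasoning
    x⁻¹ = proj₁ (inverse x x≢0)
    xx⁻¹≡1 = proj₂ (inverse x x≢0)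

  x-y≡0⇒x≡y : ∀ x y → x - y ≡ 0# → x ≡ y
  x-y≡0⇒x≡y x y eq = begin
    x          ≡⟨ solve 2 (λ x y → x := (x :- y) :+ y) refl x y ⟩
    x - y + y  ≡⟨ cong (_+ y) eq ⟩
    0# + y     ≡⟨ +-identityˡ y ⟩
    y          ∎
    where open ≡-Reasoning

  x≡y⇒x-y≡0 : ∀ x y → x ≡ y → x - y ≡ 0#
  x≡y⇒x-y≡0 x .x refl = -‿inverseʳ x

  -- Conjugating f with the enumeration gives an involution of `Fin q` with the same fixed points,
  -- so q has the parity of their number.
  fixed-points : (f : Carrier → Carrier) → (∀ x → f (f x) ≡ x) →
                 ∃ λ k → q ≡ ∑[ i < q ] ind (f (to i) ≟F to i) ℕ.+ k ℕ.* 2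
  fixed-points f ff with involution-parity (from ∘ f ∘ to) (λ i → trans (cong (from ∘ f) (strictlyInverseˡ (f (to i))))
                            (trans (cong from (ff (to i))) (strictlyInverseʳ i)))
  ... | k , eq = k , trans eq (cong (ℕ._+ k ℕ.* 2) (sum-cong-≗ λ i → ind-cong (from (f (to i)) Finₚ.≟ i) (f (to i) ≟F to i)
        (λ e → trans (sym (strictlyInverseˡ (f (to i)))) (cong to e))
        (λ e → trans (cong from e) (strictlyInverseʳ i))))

  -- When 1 + 1 = 0, adding 1 is an involution; a fixed point would force 0 = 1.
  1+1≡0⇒2∣q : 1# + 1# ≡ 0# → 2 ∣ q
  1+1≡0⇒2∣q 1+1≡0 with fixed-points (_+ 1#) (λ x → trans (+-assoc x 1# 1#) (trans (cong (x +_) 1+1≡0) (+-identityʳ x)))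
  ... | k , eq = divides k (trans eq (cong (ℕ._+ k ℕ.* 2) (∑-none _ λ i e → 0≢1 (begin
      0#                   ≡⟨ x≡y⇒x-y≡0 _ _ e ⟨
      to i + 1# - to i     ≡⟨ solve 1 (λ x → x :+ con ℤ.1ℤ :- x := con ℤ.1ℤ) refl (to i) ⟩
      1#                   ∎))))
    where open ≡-Reasoning

  -- If 1 + 1 were nonzero, negation would be an involution fixing only 0, and q would be odd.
  2∣q⇒1+1≡0 : 2 ∣ q → 1# + 1# ≡ 0#
  2∣q⇒1+1≡0 (divides l q≡l*2) with (1# + 1#) ≟F 0#
  ... | yes p = p
  ... | no 2≢0 with fixed-points -_ (λ x → solve 1 (λ x → :- (:- x) := x) refl x)
  ...   | k , eq = contradiction (begin
      suc (2 ℕ.* k)  ≡⟨ cong suc (ℕₚ.*-comm 2 k) ⟩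
      suc (k ℕ.* 2)  ≡⟨ cong (ℕ._+ k ℕ.* 2) only-zero ⟨
      _              ≡⟨ eq ⟨
      q              ≡⟨ q≡l*2 ⟩
      l ℕ.* 2        ≡⟨ ℕₚ.*-comm l 2 ⟩
      2 ℕ.* l        ∎) (odd≢even k l)
    where
    open ≡-Reasoning
    odd≢even : ∀ m n → ¬ suc (2 ℕ.* m) ≡ 2 ℕ.* n
    odd≢even m n e = ℕₚ.even≢odd n m (sym e)
    only-zero : ∑[ i < q ] ind ((- to i) ≟F to i) ≡ 1
    only-zero = ∑-unique _ (from 0#)
      (subst (λ z → - z ≡ z) (sym (strictlyInverseˡ 0#)) (solve 0 (:- con ℤ.0ℤ := con ℤ.0ℤ) refl))
      (λ j e → trans (sym (strictlyInverseʳ j)) (cong from (*-cancel-0 (1# + 1#) 2≢0 (begin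
        (1# + 1#) * to j  ≡⟨ solve 1 (λ x → (con ℤ.1ℤ :+ con ℤ.1ℤ) :* x := x :- (:- x)) refl (to j) ⟩
        to j - (- to j)   ≡⟨ x≡y⇒x-y≡0 _ _ (sym e) ⟩
        0#                ∎))))

  ∑E : (Carrier → ℕ) → ℕ
  ∑E f = ∑[ i < q ] f (to i)

  ∑E-unique : ∀ {p} {P : Pred Carrier p} (P? : Decidable P) x → P x → (∀ y → P y → y ≡ x) →
              ∑E (λ y → ind (P? y)) ≡ 1
  ∑E-unique {P = P} P? x p uniq = ∑-unique (P? ∘ to) (from x) (subst P (sym (strictlyInverseˡ x)) p)
    λ j pj → trans (sym (strictlyInverseʳ j)) (cong from (uniq (to j) pj))

  -- The head letter is summed innermost: a recurrence in the length then follows termwise, by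
  -- counting the letters d that suit a fixed tail w.
  ∑V : ∀ m → (Vec Carrier m → ℕ) → ℕ
  ∑V zero    f = f []
  ∑V (suc m) f = ∑V m λ w → ∑E λ x → f (x ∷ w)

  ∑V-cong : ∀ m {f g} → (∀ w → f w ≡ g w) → ∑V m f ≡ ∑V m g
  ∑V-cong zero    eq = eq []
  ∑V-cong (suc m) eq = ∑V-cong m λ w → sum-cong-≗ λ i → eq (to i ∷ w)

  ∑V-distrib-+ : ∀ m f g → ∑V m (λ w → f w ℕ.+ g w) ≡ ∑V m f ℕ.+ ∑V m g
  ∑V-distrib-+ zero    f g = refl
  ∑V-distrib-+ (suc m) f g = trans (∑V-cong m λ w → ∑-distrib-+ (λ i → f (to i ∷ w)) _) (∑V-distrib-+ m _ _)

  ∑V-distribˡ-* : ∀ m c f → ∑V m (λ w → c ℕ.* f w) ≡ c ℕ.* ∑V m f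
  ∑V-distribˡ-* zero    c f = refl
  ∑V-distribˡ-* (suc m) c f =
    trans (∑V-cong m λ w → sym (*-distribˡ-sum c (λ i → f (to i ∷ w)))) (∑V-distribˡ-* m c _)

  ∑V-none : ∀ {p} m {P : Pred (Vec Carrier m) p} (P? : Decidable P) → (∀ w → ¬ P w) → ∑V m (λ w → ind (P? w)) ≡ 0
  ∑V-none m P? ¬P = trans (∑V-cong m λ w → ind-no (P? w) (¬P w)) (∑V-distribˡ-* m 0 (λ _ → 0))

  ∑V-1 : ∀ m → ∑V m (λ _ → 1) ≡ q ℕ.^ m
  ∑V-1 zero    = refl
  ∑V-1 (suc m) = trans (∑V-cong m λ _ → ∑-const q 1) (trans (∑V-distribˡ-* m q (λ _ → 1)) (cong (q ℕ.*_) (∑V-1 m)))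

  ∑V-∑-comm : ∀ m n (f : Fin n → Vec Carrier m → ℕ) →
              ∑[ i < n ] ∑V m (f i) ≡ ∑V m (λ w → ∑[ i < n ] f i w)
  ∑V-∑-comm zero    n f = refl
  ∑V-∑-comm (suc m) n f = trans (∑V-∑-comm m n _) (∑V-cong m λ w → ∑-comm λ i j → f i (to j ∷ w))

  sum-allVecs : ∀ m (f : Vec Carrier m → ℕ) → ListAction.sum (List.map f (allVecs F m)) ≡ ∑V m f
  sum-allVecs zero    f = ℕₚ.+-identityʳ _
  sum-allVecs (suc m) f = begin
    ListAction.sum (List.map f (allVecs F (suc m)))
      ≡⟨ sum-map-concatMap f (λ x → List.map (x ∷_) (allVecs F m)) (allElems F) ⟩
    ListAction.sum (List.map g (List.map to (List.allFin q)))
      ≡⟨ cong ListAction.sum (Listₚ.map-∘ (List.allFin q)) ⟨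
    ListAction.sum (List.map (g ∘ to) (List.allFin q))
      ≡⟨ cong ListAction.sum (Listₚ.map-tabulate (λ i → i) (g ∘ to)) ⟩
    ListAction.sum (List.tabulate (g ∘ to))
      ≡⟨ sum-tabulate (g ∘ to) ⟩
    ∑[ i < q ] g (to i)
      ≡⟨ sum-cong-≗ (λ i → trans (cong ListAction.sum (sym (Listₚ.map-∘ (allVecs F m)))) (sum-allVecs m (λ w → f (to i ∷ w)))) ⟩
    ∑[ i < q ] ∑V m (λ w → f (to i ∷ w))
      -- `allVecs` runs through the head in the outer loop, `∑V` in the inner one.
      ≡⟨ ∑V-∑-comm m q _ ⟩
    ∑V (suc m) f ∎
    where
    open ≡-Reasoning
    g : Carrier → ℕ
    g x = ListAction.sum (List.map f (List.map (x ∷_) (allVecs F m)))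

  length-filter-allVecs : ∀ {p m} {P : Pred (Vec Carrier m) p} (P? : Decidable P) →
    List.length (List.filter P? (allVecs F m)) ≡ ∑V m (λ w → ind (P? w))
  length-filter-allVecs {m = m} P? = trans (length-filter P? (allVecs F m)) (sum-allVecs m _)

-- Transfer matrices.

module Monodromy {q : ℕ} (F : FiniteField q) where
  open Counting F
  open FiniteField F using (enum; _≟F_; inverse; 0≢1)
  open Inverse enum using (to)
  open CommutativeRing ringF hiding (refl; sym; trans; setoid; zero)
  open IntegerCoefficients ringF using (solve; con; _:=_; _:+_; _:*_; _:-_; :-_)
  open ≡-Reasoning

  Point : Set
  Point = Carrier × Carrier

  -- One step of xᵢ₋₁ = bᵢ − (xᵢ₊₁ + dᵢ xᵢ), run downwards on the pair (xᵢ₊₁ , xᵢ).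
  step : Carrier → Carrier → Point → Point
  step b d p = proj₂ p , b - (proj₁ p + d * proj₂ p)

  orbit : ∀ {m} → Vec Carrier m → Vec Carrier m → Point → Point
  orbit []       []       p = p
  orbit (b ∷ bs) (d ∷ ds) p = step b d (orbit bs ds p)

  transfer : ∀ {m} → Vec Carrier m → Point → Point
  transfer {m} = orbit (Vec.replicate m 0#)

  -- The entries of T(w), with rows (α , β) and (γ , δ). Prepending d gives the rows (γ , δ) and -(α
  -- , β) - d (γ , δ), so the column (β , δ) evolves independently of the other one.
  α β γ δ trace : ∀ {m} → Vec Carrier m → Carrier
  α w = proj₁ (transfer w (1# , 0#))
  β w = proj₁ (transfer w (0# , 1#))
  γ w = proj₂ (transfer w (1# , 0#))
  δ w = proj₂ (transfer w (0# , 1#))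
  trace w = α w + δ w

  -- Each step matrix, with rows (0 , 1) and (-1 , -d), has determinant 1.
  transfer-det : ∀ {m} (w : Vec Carrier m) → α w * δ w - β w * γ w ≡ 1#
  transfer-det []      = solve 0 (con ℤ.1ℤ :* con ℤ.1ℤ :- con ℤ.0ℤ :* con ℤ.0ℤ := con ℤ.1ℤ) refl
  transfer-det (d ∷ w) = trans
    (solve 5 (λ a b c e d → c :* (con ℤ.0ℤ :- (b :+ d :* e)) :- e :* (con ℤ.0ℤ :- (a :+ d :* c)) := a :* e :- b :* c)
      refl (α w) (β w) (γ w) (δ w) d)
    (transfer-det w)

  -- Every step is affine with a linear part that does not involve b. Hence one matrix T(w) governs
  -- the equations (A + D) x = b for all right-hand sides at once.
  orbit-affine : ∀ {m} (b w : Vec Carrier m) u v →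
    proj₁ (orbit b w (u , v)) ≡ u * α w + v * β w + proj₁ (orbit b w (0# , 0#)) ×
    proj₂ (orbit b w (u , v)) ≡ u * γ w + v * δ w + proj₂ (orbit b w (0# , 0#))
  orbit-affine [] [] u v =
    solve 2 (λ u v → u := u :* con ℤ.1ℤ :+ v :* con ℤ.0ℤ :+ con ℤ.0ℤ) refl u v ,
    solve 2 (λ u v → v := u :* con ℤ.0ℤ :+ v :* con ℤ.1ℤ :+ con ℤ.0ℤ) refl u v
  orbit-affine (b ∷ bs) (d ∷ w) u v with orbit-affine bs w u v
  ... | eq₁ , eq₂ = eq₂ , trans (cong₂ (λ x y → b - (x + d * y)) eq₁ eq₂)
    (solve 10 (λ u v a b′ c e s t b d →
        b :- (u :* a :+ v :* b′ :+ s :+ d :* (u :* c :+ v :* e :+ t))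
        := u :* (con ℤ.0ℤ :- (a :+ d :* c)) :+ v :* (con ℤ.0ℤ :- (b′ :+ d :* e)) :+ (b :- (s :+ d :* t)))
      refl u v (α w) (β w) (γ w) (δ w) (proj₁ (orbit bs w (0# , 0#))) (proj₂ (orbit bs w (0# , 0#))) b d)

  transfer-0 : ∀ {m} (w : Vec Carrier m) → transfer w (0# , 0#) ≡ (0# , 0#)
  transfer-0 []      = refl
  transfer-0 (d ∷ w) = trans (cong (step 0# d) (transfer-0 w))
    (cong (0# ,_) (solve 1 (λ d → con ℤ.0ℤ :- (con ℤ.0ℤ :+ d :* con ℤ.0ℤ) := con ℤ.0ℤ) refl d))

  transfer-linear : ∀ {m} (w : Vec Carrier m) u v →
    transfer w (u , v) ≡ (u * α w + v * β w , u * γ w + v * δ w)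
  transfer-linear {m} w u v with orbit-affine (Vec.replicate m 0#) w u v
  ... | eq₁ , eq₂ = cong₂ _,_
    (trans eq₁ (trans (cong (λ p → u * α w + v * β w + proj₁ p) (transfer-0 w)) (+-identityʳ _)))
    (trans eq₂ (trans (cong (λ p → u * γ w + v * δ w + proj₂ p) (transfer-0 w)) (+-identityʳ _)))

  -- The left side is det (T - I) = det T + 1 - tr T, and det T = 1.
  charpoly-at-1 : ∀ {m} (w : Vec Carrier m) →
    (α w - 1#) * (δ w - 1#) - β w * γ w ≡ (1# + 1#) - trace w
  charpoly-at-1 w = begin
    (α w - 1#) * (δ w - 1#) - β w * γ w
      ≡⟨ solve 4 (λ a b c e → (a :- con ℤ.1ℤ) :* (e :- con ℤ.1ℤ) :- b :* c
                  := (a :* e :- b :* c) :+ con ℤ.1ℤ :- (a :+ e)) refl (α w) (β w) (γ w) (δ w) ⟩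
    (α w * δ w - β w * γ w) + 1# - trace w
      ≡⟨ cong (λ t → t + 1# - trace w) (transfer-det w) ⟩
    (1# + 1#) - trace w ∎

  -- A fixed point solves (T - I) p = -(s , t), where (s , t) is the orbit of the origin. The
  -- determinant 2 - tr T is nonzero, so Cramer's rule applies.
  orbit-fixed-point : ∀ {m} (w : Vec Carrier m) → ¬ trace w ≡ 1# + 1# →
                      ∀ b → ∃ λ p → orbit b w p ≡ p
  orbit-fixed-point w tr≢2 b = (u , v) , cong₂ _,_
    (trans (proj₁ (orbit-affine b w u v)) (trans
      (solve 7 (λ a b c e s t i →
         let dd = (a :- con ℤ.1ℤ) :* (e :- con ℤ.1ℤ) :- b :* c
             u = i :* (b :* t :- (e :- con ℤ.1ℤ) :* s)
             v = i :* (c :* s :- (a :- con ℤ.1ℤ) :* t)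
         in u :* a :+ v :* b :+ s := u :+ s :* (con ℤ.1ℤ :- dd :* i))
        refl (α w) (β w) (γ w) (δ w) s t i) (vanish u s)))
    (trans (proj₂ (orbit-affine b w u v)) (trans
      (solve 7 (λ a b c e s t i →
         let dd = (a :- con ℤ.1ℤ) :* (e :- con ℤ.1ℤ) :- b :* c
             u = i :* (b :* t :- (e :- con ℤ.1ℤ) :* s)
             v = i :* (c :* s :- (a :- con ℤ.1ℤ) :* t)
         in u :* c :+ v :* e :+ t := v :+ t :* (con ℤ.1ℤ :- dd :* i))
        refl (α w) (β w) (γ w) (δ w) s t i) (vanish v t)))
    where
    s = proj₁ (orbit b w (0# , 0#))
    t = proj₂ (orbit b w (0# , 0#))
    D = (α w - 1#) * (δ w - 1#) - β w * γ w
    inv = inverse D λ D≡0 → tr≢2 (sym (x-y≡0⇒x≡y _ _ (trans (sym (charpoly-at-1 w)) D≡0)))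
    i = proj₁ inv
    -- The Cramer numerators times the inverse `i` of `D`. Substituting them leaves a residue
    -- `1# - D * i`, which `vanish` removes.
    u = i * (β w * t - (δ w - 1#) * s)
    v = i * (γ w * s - (α w - 1#) * t)
    vanish : ∀ x y → x + y * (1# - D * i) ≡ x
    vanish x y = trans (cong (λ z → x + y * (1# - z)) (proj₂ inv))
      (solve 2 (λ x y → x :+ y :* (con ℤ.1ℤ :- con ℤ.1ℤ) := x) refl x y)

  -- T - I is singular here. The vector (β , 1 - α) is annihilated by its first row (α - 1 , β), and
  -- by its second because the determinant is 0.
  transfer-fixed-vector : ∀ {m} (w : Vec Carrier m) → trace w ≡ 1# + 1# →
                          ∃ λ p → ¬ p ≡ (0# , 0#) × transfer w p ≡ p
  transfer-fixed-vector w tr≡2 with (β w ≟F 0#) ×-dec (α w ≟F 1#)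
  ... | no ¬eq = (β w , 1# - α w) ,
    (λ eq → ¬eq (cong proj₁ eq , sym (x-y≡0⇒x≡y _ _ (cong proj₂ eq)))) ,
    trans (transfer-linear w (β w) (1# - α w)) (cong₂ _,_
      (solve 2 (λ a b → b :* a :+ (con ℤ.1ℤ :- a) :* b := b) refl (α w) (β w))
      (begin
        β w * γ w + (1# - α w) * δ w
          ≡⟨ solve 4 (λ a b c e → b :* c :+ (con ℤ.1ℤ :- a) :* e
               := (con ℤ.1ℤ :- a) :- ((a :- con ℤ.1ℤ) :* (e :- con ℤ.1ℤ) :- b :* c)) refl (α w) (β w) (γ w) (δ w) ⟩
        (1# - α w) - ((α w - 1#) * (δ w - 1#) - β w * γ w)
          ≡⟨ cong (λ z → (1# - α w) - z) (trans (charpoly-at-1 w) (x≡y⇒x-y≡0 _ _ (sym tr≡2))) ⟩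
        (1# - α w) - 0#
          ≡⟨ solve 1 (λ x → x :- con ℤ.0ℤ := x) refl (1# - α w) ⟩
        1# - α w ∎))
  -- The candidate (β , 1 - α) is zero here, so T has first row (1 , 0). The trace then forces δ =
  -- 1, and (0 , 1) is fixed.
  ... | yes (β≡0 , α≡1) = (0# , 1#) , (λ eq → 0≢1 (sym (cong proj₂ eq))) , cong₂ _,_ β≡0 (begin
    δ w                  ≡⟨ solve 2 (λ a e → e := (a :+ e) :- a) refl (α w) (δ w) ⟩
    trace w - α w        ≡⟨ cong₂ _-_ tr≡2 α≡1 ⟩
    (1# + 1#) - 1#       ≡⟨ solve 0 ((con ℤ.1ℤ :+ con ℤ.1ℤ) :- con ℤ.1ℤ := con ℤ.1ℤ) refl ⟩
    1#                   ∎)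

  -- A vanishing column would contradict determinant 1.
  βδ≢0 : ∀ {m} (w : Vec Carrier m) → ¬ (β w ≡ 0# × δ w ≡ 0#)
  βδ≢0 w (β≡0 , δ≡0) = 0≢1 (begin
    0#                          ≡⟨ solve 2 (λ a c → con ℤ.0ℤ := a :* con ℤ.0ℤ :- con ℤ.0ℤ :* c) refl (α w) (γ w) ⟩
    α w * 0# - 0# * γ w         ≡⟨ cong₂ (λ b e → α w * e - b * γ w) β≡0 δ≡0 ⟨
    α w * δ w - β w * γ w       ≡⟨ transfer-det w ⟩
    1#                          ∎)

  -- For y ≠ 0 the equation in d has exactly one root. For y = 0 it does not involve d, so all q
  -- letters or none satisfy it. The two indicators merge both cases into one expression that can be
  -- summed over words.
  affine-count : ∀ g x y c → ∑E (λ d → ind ((g - (x + d * y)) ≟F c)) ≡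
                 ind (¬? (y ≟F 0#)) ℕ.+ q ℕ.* ind ((x ≟F (g - c)) ×-dec (y ≟F 0#))
  affine-count g x y c = helper (y ≟F 0#)
    where
    helper : Dec (y ≡ 0#) → _
    helper (yes y≡0) = begin
      ∑E (λ d → ind ((g - (x + d * y)) ≟F c))
        ≡⟨ sum-cong-≗ (λ i → ind-cong ((g - (x + to i * y)) ≟F c) ((x ≟F (g - c)) ×-dec (y ≟F 0#))
             (λ e → trans (shift₁ (to i)) (cong (λ z → g - z) e) , y≡0)
             (λ e → trans (shift₂ (to i)) (trans (cong (λ z → g - z) (proj₁ e)) (solve 2 (λ g c → g :- (g :- c) := c) refl g c)))) ⟩
      ∑E (λ _ → ind ((x ≟F (g - c)) ×-dec (y ≟F 0#)))
        ≡⟨ ∑-const q _ ⟩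
      q ℕ.* ind ((x ≟F (g - c)) ×-dec (y ≟F 0#))
        ≡⟨ cong (ℕ._+ q ℕ.* ind ((x ≟F (g - c)) ×-dec (y ≟F 0#))) (ind-no (¬? (y ≟F 0#)) λ ¬e → ¬e y≡0) ⟨
      ind (¬? (y ≟F 0#)) ℕ.+ q ℕ.* ind ((x ≟F (g - c)) ×-dec (y ≟F 0#)) ∎
      where
      shift₁ : ∀ d → x ≡ g - (g - (x + d * y))
      shift₁ d = begin
        x                          ≡⟨ solve 3 (λ g x d → x := g :- (g :- (x :+ d :* con ℤ.0ℤ))) refl g x d ⟩
        g - (g - (x + d * 0#))     ≡⟨ cong (λ z → g - (g - (x + d * z))) y≡0 ⟨
        g - (g - (x + d * y))      ∎
      shift₂ : ∀ d → g - (x + d * y) ≡ g - x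
      shift₂ d = trans (cong (λ z → g - (x + d * z)) y≡0) (solve 3 (λ g x d → g :- (x :+ d :* con ℤ.0ℤ) := g :- x) refl g x d)
    helper (no y≢0) = begin
      ∑E (λ d → ind ((g - (x + d * y)) ≟F c))
        ≡⟨ ∑E-unique (λ d → (g - (x + d * y)) ≟F c) d₀ d₀-root d₀-unique ⟩
      1
        ≡⟨ cong₂ ℕ._+_ (ind-yes (¬? (y ≟F 0#)) y≢0)
             (trans (cong (q ℕ.*_) (ind-no ((x ≟F (g - c)) ×-dec (y ≟F 0#)) (λ e → y≢0 (proj₂ e)))) (ℕₚ.*-zeroʳ q)) ⟨
      ind (¬? (y ≟F 0#)) ℕ.+ q ℕ.* ind ((x ≟F (g - c)) ×-dec (y ≟F 0#)) ∎
      where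
      y⁻¹ = proj₁ (inverse y y≢0)
      d₀ = (g - x - c) * y⁻¹
      d₀-root : g - (x + d₀ * y) ≡ c
      d₀-root = begin
        g - (x + (g - x - c) * y⁻¹ * y)
          ≡⟨ solve 5 (λ g x y c i → g :- (x :+ (g :- x :- c) :* i :* y) := g :- (x :+ (g :- x :- c) :* (y :* i))) refl g x y c y⁻¹ ⟩
        g - (x + (g - x - c) * (y * y⁻¹))
          ≡⟨ cong (λ z → g - (x + (g - x - c) * z)) (proj₂ (inverse y y≢0)) ⟩
        g - (x + (g - x - c) * 1#)
          ≡⟨ solve 3 (λ g x c → g :- (x :+ (g :- x :- c) :* con ℤ.1ℤ) := c) refl g x c ⟩
        c ∎
      d₀-unique : ∀ d → g - (x + d * y) ≡ c → d ≡ d₀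
      d₀-unique d d-root = x-y≡0⇒x≡y d d₀ (*-cancel-0 y y≢0 (begin
        y * (d - d₀)
          ≡⟨ solve 5 (λ g x y d d₀ → y :* (d :- d₀) := (g :- (x :+ d₀ :* y)) :- (g :- (x :+ d :* y))) refl g x y d d₀ ⟩
        (g - (x + d₀ * y)) - (g - (x + d * y))
          ≡⟨ x≡y⇒x-y≡0 _ _ (trans d₀-root (sym d-root)) ⟩
        0# ∎))

  -- Recurrences for the word counts.

  #δ= : ℕ → Carrier → ℕ
  #δ= m c = ∑V m λ w → ind (δ w ≟F c)

  #δ≢0 : ℕ → ℕ
  #δ≢0 m = ∑V m λ w → ind (¬? (δ w ≟F 0#))

  #βδ : Carrier → ℕ → ℕ
  #βδ c m = ∑V m λ w → ind ((β w ≟F c) ×-dec (δ w ≟F 0#))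

  #trace=2 : ℕ → ℕ
  #trace=2 m = ∑V m λ w → ind (trace w ≟F (1# + 1#))

  #δ=0+#δ≢0 : ∀ m → #δ= m 0# ℕ.+ #δ≢0 m ≡ q ℕ.^ m
  #δ=0+#δ≢0 m = begin
    #δ= m 0# ℕ.+ #δ≢0 m                                      ≡⟨ ∑V-distrib-+ m _ _ ⟨
    ∑V m (λ w → ind (δ w ≟F 0#) ℕ.+ ind (¬? (δ w ≟F 0#)))    ≡⟨ ∑V-cong m (λ w → ind-¬ (δ w ≟F 0#)) ⟩
    ∑V m (λ _ → 1)                                           ≡⟨ ∑V-1 m ⟩
    q ℕ.^ m                                                  ∎

  ∑V-affine-count : ∀ m c (P? : ∀ w → Dec ((β {m} w ≡ c) × (δ w ≡ 0#))) →
    ∑V m (λ w → ind (¬? (δ w ≟F 0#)) ℕ.+ q ℕ.* ind (P? w)) ≡ #δ≢0 m ℕ.+ q ℕ.* ∑V m (λ w → ind (P? w))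
  ∑V-affine-count m c P? = trans (∑V-distrib-+ m _ _) (cong (#δ≢0 m ℕ.+_) (∑V-distribˡ-* m q _))

  -- δ(d ∷ w) = -(β + d δ) is affine in d; in the degenerate case δ = 0 it equals c exactly when β =
  -- -c.
  #δ=-suc : ∀ m c → #δ= (suc m) c ≡ #δ≢0 m ℕ.+ q ℕ.* #βδ (- c) m
  #δ=-suc m c = trans
    (∑V-cong m λ w → trans (affine-count 0# (β w) (δ w) c)
      (cong (λ x → ind (¬? (δ w ≟F 0#)) ℕ.+ q ℕ.* ind ((β w ≟F x) ×-dec (δ w ≟F 0#))) (+-identityˡ (- c))))
    (∑V-affine-count m (- c) _)

  -- For c = 0 the degenerate case would need β = δ = 0, which the determinant excludes.
  #δ=0-suc : ∀ m → #δ= (suc m) 0# ≡ #δ≢0 m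
  #δ=0-suc m = begin
    #δ= (suc m) 0#                       ≡⟨ #δ=-suc m 0# ⟩
    #δ≢0 m ℕ.+ q ℕ.* #βδ (- 0#) m      ≡⟨ cong (λ k → #δ≢0 m ℕ.+ q ℕ.* k) (∑V-none m (λ w → (β w ≟F (- 0#)) ×-dec (δ w ≟F 0#)) λ w e →
                                              βδ≢0 w (trans (proj₁ e) -0≡0 , proj₂ e)) ⟩
    #δ≢0 m ℕ.+ q ℕ.* 0                   ≡⟨ cong (#δ≢0 m ℕ.+_) (ℕₚ.*-zeroʳ q) ⟩
    #δ≢0 m ℕ.+ 0                         ≡⟨ ℕₚ.+-identityʳ _ ⟩
    #δ≢0 m                               ∎
    where
    -0≡0 : - 0# ≡ 0#
    -0≡0 = solve 0 (:- con ℤ.0ℤ := con ℤ.0ℤ) refl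

  -- β(d ∷ w) is δ(w). If that is c ≠ 0, then exactly one letter d makes δ(d ∷ w) vanish.
  #βδ-suc : ∀ m c → ¬ c ≡ 0# → #βδ c (suc m) ≡ #δ= m c
  #βδ-suc m c c≢0 = ∑V-cong m λ w → helper w (δ w ≟F c)
    where
    helper : ∀ w (e : Dec (δ {m} w ≡ c)) →
      ∑E (λ d → ind ((δ w ≟F c) ×-dec ((0# - (β w + d * δ w)) ≟F 0#))) ≡ ind (δ w ≟F c)
    helper w (yes δ≡c) = begin
      ∑E (λ d → ind ((δ w ≟F c) ×-dec ((0# - (β w + d * δ w)) ≟F 0#)))
        ≡⟨ sum-cong-≗ (λ i → ind-cong ((δ w ≟F c) ×-dec ((0# - (β w + to i * δ w)) ≟F 0#))
             ((0# - (β w + to i * δ w)) ≟F 0#) proj₂ (δ≡c ,_)) ⟩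
      ∑E (λ d → ind ((0# - (β w + d * δ w)) ≟F 0#))
        ≡⟨ affine-count 0# (β w) (δ w) 0# ⟩
      ind (¬? (δ w ≟F 0#)) ℕ.+ q ℕ.* ind ((β w ≟F (0# - 0#)) ×-dec (δ w ≟F 0#))
        ≡⟨ cong₂ (λ k l → k ℕ.+ q ℕ.* l) (ind-yes (¬? (δ w ≟F 0#)) δ≢0) (ind-no ((β w ≟F (0# - 0#)) ×-dec (δ w ≟F 0#)) (δ≢0 ∘ proj₂)) ⟩
      1 ℕ.+ q ℕ.* 0
        ≡⟨ cong suc (ℕₚ.*-zeroʳ q) ⟩
      1
        ≡⟨ ind-yes (δ w ≟F c) δ≡c ⟨
      ind (δ w ≟F c) ∎
      where
      δ≢0 : ¬ δ w ≡ 0#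
      δ≢0 δ≡0 = c≢0 (trans (sym δ≡c) δ≡0)
    helper w (no δ≢c) = trans (∑-none (λ i → (δ w ≟F c) ×-dec ((0# - (β w + to i * δ w)) ≟F 0#)) (λ i → δ≢c ∘ proj₁))
      (sym (ind-no (δ w ≟F c) δ≢c))

  -- Two letters turn c into -c, so the counts for 1 and -1 form a closed system once the words with
  -- δ = 0 are known.
  #βδ-suc-suc : ∀ m c → ¬ c ≡ 0# → #βδ c (suc (suc m)) ≡ #δ= (suc m) 0# ℕ.+ q ℕ.* #βδ (- c) m
  #βδ-suc-suc m c c≢0 = begin
    #βδ c (suc (suc m))                      ≡⟨ #βδ-suc (suc m) c c≢0 ⟩
    #δ= (suc m) c                                ≡⟨ #δ=-suc m c ⟩
    #δ≢0 m ℕ.+ q ℕ.* #βδ (- c) m               ≡⟨ cong (ℕ._+ q ℕ.* #βδ (- c) m) (#δ=0-suc m) ⟨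
    #δ= (suc m) 0# ℕ.+ q ℕ.* #βδ (- c) m       ∎

  -- The new trace γ - (β + d δ) is affine in d, and for δ = 0 it is 2 exactly when β = -1. The
  -- right side has the shape of `#βδ-suc-suc` for c = 1, so the same computation evaluates both.
  #trace=2-suc : ∀ m → #trace=2 (suc m) ≡ #δ= (suc m) 0# ℕ.+ q ℕ.* #βδ (- 1#) m
  #trace=2-suc m = begin
    #trace=2 (suc m)
      ≡⟨ ∑V-cong m (λ w → trans (sum-cong-≗ λ i → cong (λ t → ind (t ≟F (1# + 1#)))
           (solve 4 (λ b c e d → c :+ (con ℤ.0ℤ :- (b :+ d :* e)) := c :- (b :+ d :* e)) refl (β w) (γ w) (δ w) (to i)))
           (affine-count (γ w) (β w) (δ w) (1# + 1#))) ⟩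
    ∑V m (λ w → ind (¬? (δ w ≟F 0#)) ℕ.+ q ℕ.* ind ((β w ≟F (γ w - (1# + 1#))) ×-dec (δ w ≟F 0#)))
      ≡⟨ ∑V-cong m (λ w → cong (λ k → ind (¬? (δ w ≟F 0#)) ℕ.+ q ℕ.* k)
           (ind-cong ((β w ≟F (γ w - (1# + 1#))) ×-dec (δ w ≟F 0#)) ((β w ≟F (- 1#)) ×-dec (δ w ≟F 0#))
             (λ (e , δ≡0) → β≡-1 w δ≡0 e , δ≡0)
             (λ (e , δ≡0) → β≡γ-2 w δ≡0 e , δ≡0))) ⟩
    ∑V m (λ w → ind (¬? (δ w ≟F 0#)) ℕ.+ q ℕ.* ind ((β w ≟F (- 1#)) ×-dec (δ w ≟F 0#)))
      ≡⟨ ∑V-affine-count m (- 1#) _ ⟩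
    #δ≢0 m ℕ.+ q ℕ.* #βδ (- 1#) m
      ≡⟨ cong (ℕ._+ q ℕ.* #βδ (- 1#) m) (#δ=0-suc m) ⟨
    #δ= (suc m) 0# ℕ.+ q ℕ.* #βδ (- 1#) m ∎
    where
    βγ≡-1 : ∀ w → δ {m} w ≡ 0# → β w * γ w + 1# ≡ 0#
    βγ≡-1 w δ≡0 = begin
      β w * γ w + 1#                            ≡⟨ cong (β w * γ w +_) (transfer-det w) ⟨
      β w * γ w + (α w * δ w - β w * γ w)       ≡⟨ cong (λ z → β w * γ w + (α w * z - β w * γ w)) δ≡0 ⟩
      β w * γ w + (α w * 0# - β w * γ w)        ≡⟨ solve 3 (λ a b c → b :* c :+ (a :* con ℤ.0ℤ :- b :* c) := con ℤ.0ℤ) refl (α w) (β w) (γ w) ⟩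
      0#                                        ∎
    square-0 : ∀ x → x * x ≡ 0# → x ≡ 0#
    square-0 x xx≡0 with x ≟F 0#
    ... | yes x≡0 = x≡0
    ... | no x≢0  = *-cancel-0 x x≢0 xx≡0
    -- With δ = 0 the determinant gives βγ = -1. Together with β = γ - 2 this makes (β + 1)² zero,
    -- and a field has no nonzero nilpotents.
    β≡-1 : ∀ w → δ {m} w ≡ 0# → β w ≡ γ w - (1# + 1#) → β w ≡ - 1#
    β≡-1 w δ≡0 e = x-y≡0⇒x≡y _ _ (square-0 (β w - - 1#) (begin
      (β w - - 1#) * (β w - - 1#)
        ≡⟨ solve 2 (λ b c → (b :- :- con ℤ.1ℤ) :* (b :- :- con ℤ.1ℤ)
             := (b :* c :+ con ℤ.1ℤ) :+ b :* (b :- (c :- (con ℤ.1ℤ :+ con ℤ.1ℤ)))) refl (β w) (γ w) ⟩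
      (β w * γ w + 1#) + β w * (β w - (γ w - (1# + 1#)))
        ≡⟨ cong₂ (λ x y → x + β w * y) (βγ≡-1 w δ≡0) (x≡y⇒x-y≡0 _ _ e) ⟩
      0# + β w * 0#
        ≡⟨ solve 1 (λ b → con ℤ.0ℤ :+ b :* con ℤ.0ℤ := con ℤ.0ℤ) refl (β w) ⟩
      0# ∎))
    β≡γ-2 : ∀ w → δ {m} w ≡ 0# → β w ≡ - 1# → β w ≡ γ w - (1# + 1#)
    β≡γ-2 w δ≡0 e = x-y≡0⇒x≡y _ _ (begin
      β w - (γ w - (1# + 1#))
        ≡⟨ solve 2 (λ b c → b :- (c :- (con ℤ.1ℤ :+ con ℤ.1ℤ))
             := (b :* c :+ con ℤ.1ℤ) :+ (con ℤ.1ℤ :- c) :* (b :- :- con ℤ.1ℤ)) refl (β w) (γ w) ⟩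
      (β w * γ w + 1#) + (1# - γ w) * (β w - - 1#)
        ≡⟨ cong₂ (λ x y → x + (1# - γ w) * y) (βγ≡-1 w δ≡0) (x≡y⇒x-y≡0 _ _ e) ⟩
      0# + (1# - γ w) * 0#
        ≡⟨ solve 1 (λ c → con ℤ.0ℤ :+ c :* con ℤ.0ℤ := con ℤ.0ℤ) refl (1# - γ w) ⟩
      0# ∎)

  #δ=0-zero : #δ= 0 0# ≡ 0
  #δ=0-zero = ind-no (1# ≟F 0#) (0≢1 ∘ sym)

  #βδ-zero : ∀ c → #βδ c 0 ≡ 0
  #βδ-zero c = ind-no ((0# ≟F c) ×-dec (1# ≟F 0#)) (0≢1 ∘ sym ∘ proj₂)

  -- The empty word has δ = 1. For c = -1 this initial value records whether 1 = -1, the source of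
  -- the split by the parity of q.
  #βδ-one : ∀ c → ¬ c ≡ 0# → #βδ c 1 ≡ ind (1# ≟F c)
  #βδ-one c c≢0 = #βδ-suc 0 c c≢0

-- Neighbours on the cycle.

next prev : ∀ {n} → Fin (suc n) → Fin (suc n)
next i with view i
... | ‵fromℕ     = zero
... | ‵inject₁ j = suc j
prev zero    = fromℕ _
prev (suc i) = inject₁ i

toℕ-next : ∀ {n} (i : Fin (suc n)) →
           (toℕ (next i) ≡ suc (toℕ i)) ⊎ (suc (toℕ i) ≡ suc n × toℕ (next i) ≡ 0)
toℕ-next {n} i with view i
... | ‵fromℕ     = inj₂ (cong suc (Finₚ.toℕ-fromℕ n) , refl)
... | ‵inject₁ j = inj₁ (cong suc (sym (Finₚ.toℕ-inject₁ j)))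

toℕ-prev : ∀ {n} (i : Fin (suc n)) →
           (toℕ i ≡ suc (toℕ (prev i))) ⊎ (suc (toℕ (prev i)) ≡ suc n × toℕ i ≡ 0)
toℕ-prev {n} zero    = inj₂ (cong suc (Finₚ.toℕ-fromℕ n) , refl)
toℕ-prev     (suc i) = inj₁ (cong suc (sym (Finₚ.toℕ-inject₁ i)))

next≢i : ∀ {n} (i : Fin (suc (suc n))) → ¬ next i ≡ i
next≢i i e with toℕ-next i
... | inj₁ eq = ℕₚ.1+n≢n (trans (sym eq) (cong toℕ e))
... | inj₂ (eq , eq₀) with trans (sym (cong suc (trans (cong toℕ (sym e)) eq₀))) eq
...   | ()

prev≢i : ∀ {n} (i : Fin (suc (suc n))) → ¬ prev i ≡ i
prev≢i i e with toℕ-prev i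
... | inj₁ eq = ℕₚ.1+n≢n (trans (sym eq) (cong toℕ (sym e)))
... | inj₂ (eq , eq₀) with trans (sym (cong suc (trans (cong toℕ e) eq₀))) eq
...   | ()

-- On two vertices both neighbours coincide; at least three are needed for a row of the adjacency
-- matrix to have two separate entries 1.
next≢prev : ∀ {n} (i : Fin (suc (suc (suc n)))) → ¬ next i ≡ prev i
next≢prev i e with toℕ-next i | toℕ-prev i
... | inj₁ t≡1+i | inj₁ i≡1+p = ℕₚ.m≢1+n+m (toℕ i) {1}
      (trans i≡1+p (cong suc (trans (cong toℕ (sym e)) t≡1+i)))
... | inj₁ t≡1+i | inj₂ (1+p≡m , i≡0)
      with trans (sym 1+p≡m) (cong suc (trans (cong toℕ (sym e)) (trans t≡1+i (cong suc i≡0))))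
...   | ()
next≢prev i e | inj₂ (1+i≡m , t≡0) | inj₁ i≡1+p
      with trans (sym 1+i≡m) (cong suc (trans i≡1+p (cong suc (trans (cong toℕ (sym e)) t≡0))))
...   | ()
next≢prev i e | inj₂ (1+i≡m , t≡0) | inj₂ (1+p≡m , i≡0) with trans (sym 1+i≡m) (cong suc i≡0)
...   | ()

-- Invertibility of A + D and the trace of the transfer matrix.

module Cycle {q : ℕ} (F : FiniteField q) where
  open Counting F
  open Monodromy F
  open FiniteField F using (_≟F_)
  open CommutativeRing ringF hiding (refl; sym; trans; setoid; zero)
  open IntegerCoefficients ringF using (solve; con; _:=_; _:+_; _:*_; _:-_)
  open ≡-Reasoning
  module ∑F = Sum semiring

  -- The four disjuncts of `CycleEdge` are the ordinary and the wrap-around edge in each direction;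
  -- bounds on `toℕ` rule out the mismatched cases.
  edge⇒next⊎prev : ∀ {n} (i j : Fin (suc n)) → CycleEdge F (suc n) i j → next i ≡ j ⊎ prev i ≡ j
  edge⇒next⊎prev i j (inj₁ j≡1+i) with toℕ-next i
  ... | inj₁ t≡1+i       = inj₁ (Finₚ.toℕ-injective (trans t≡1+i (sym j≡1+i)))
  ... | inj₂ (1+i≡m , _) = contradiction (trans j≡1+i 1+i≡m) (ℕₚ.<⇒≢ (Finₚ.toℕ<n j))
  edge⇒next⊎prev i j (inj₂ (inj₁ i≡1+j)) with toℕ-prev i
  ... | inj₁ i≡1+p       = inj₂ (Finₚ.toℕ-injective (ℕₚ.suc-injective (trans (sym i≡1+p) i≡1+j)))
  ... | inj₂ (_ , i≡0)   = contradiction (trans (sym i≡1+j) i≡0) λ ()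
  edge⇒next⊎prev i j (inj₂ (inj₂ (inj₁ (1+i≡m , j≡0)))) with toℕ-next i
  ... | inj₁ t≡1+i       = contradiction (trans t≡1+i 1+i≡m) (ℕₚ.<⇒≢ (Finₚ.toℕ<n (next i)))
  ... | inj₂ (_ , t≡0)   = inj₁ (Finₚ.toℕ-injective (trans t≡0 (sym j≡0)))
  edge⇒next⊎prev i j (inj₂ (inj₂ (inj₂ (1+j≡m , i≡0)))) with toℕ-prev i
  ... | inj₁ i≡1+p       = contradiction (trans (sym i≡1+p) i≡0) λ ()
  ... | inj₂ (1+p≡m , _) = inj₂ (Finₚ.toℕ-injective (ℕₚ.suc-injective (trans 1+p≡m (sym 1+j≡m))))

  edge-next : ∀ {n} (i : Fin (suc n)) → CycleEdge F (suc n) i (next i)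
  edge-next i with toℕ-next i
  ... | inj₁ e = inj₁ e
  ... | inj₂ e = inj₂ (inj₂ (inj₁ e))

  edge-prev : ∀ {n} (i : Fin (suc n)) → CycleEdge F (suc n) i (prev i)
  edge-prev i with toℕ-prev i
  ... | inj₁ e = inj₂ (inj₁ e)
  ... | inj₂ e = inj₂ (inj₂ (inj₂ e))

  edge-sym : ∀ {m} i j → CycleEdge F m i j → CycleEdge F m j i
  edge-sym i j (inj₁ e)               = inj₂ (inj₁ e)
  edge-sym i j (inj₂ (inj₁ e))        = inj₁ e
  edge-sym i j (inj₂ (inj₂ (inj₁ e))) = inj₂ (inj₂ (inj₂ e))
  edge-sym i j (inj₂ (inj₂ (inj₂ e))) = inj₂ (inj₂ (inj₁ e))

  cycleAdj-edge : ∀ {m} i j → CycleEdge F m i j → cycleAdj F m i j ≡ 1#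
  cycleAdj-edge {m} i j e with cycleEdge? F m i j
  ... | yes _ = refl
  ... | no ¬e = contradiction e ¬e

  cycleAdj-¬edge : ∀ {m} i j → ¬ CycleEdge F m i j → cycleAdj F m i j ≡ 0#
  cycleAdj-¬edge {m} i j ¬e with cycleEdge? F m i j
  ... | yes e = contradiction e ¬e
  ... | no _  = refl

  cycleAdj-sym : ∀ {m} i j → cycleAdj F m i j ≡ cycleAdj F m j i
  cycleAdj-sym {m} i j with cycleEdge? F m i j
  ... | yes e = sym (cycleAdj-edge j i (edge-sym i j e))
  ... | no ¬e = sym (cycleAdj-¬edge j i (¬e ∘ edge-sym j i))

  schrodinger-≢ : ∀ {m} (A : Matrix F m) d {i j} → ¬ i ≡ j → schrodinger F A d i j ≡ A i j
  schrodinger-≢ A d {i} {j} i≢j with i Finₚ.≟ j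
  ... | yes e = contradiction e i≢j
  ... | no _  = refl

  schrodinger-refl : ∀ {m} (A : Matrix F m) d i → schrodinger F A d i i ≡ A i i + lookup d i
  schrodinger-refl A d i with i Finₚ.≟ i
  ... | yes _  = refl
  ... | no i≢i = contradiction refl i≢i

  schrodinger-sym : ∀ {m} (A : Matrix F m) → (∀ i j → A i j ≡ A j i) →
                    ∀ d i j → schrodinger F A d i j ≡ schrodinger F A d j i
  schrodinger-sym A A-sym d i j with i Finₚ.≟ j
  ... | yes refl = sym (schrodinger-refl A d i)
  ... | no i≢j   = trans (A-sym i j) (sym (schrodinger-≢ A d (i≢j ∘ sym)))

  identity-refl : ∀ {m} (i : Fin m) → identity F i i ≡ 1#
  identity-refl i with i Finₚ.≟ i
  ... | yes _  = refl
  ... | no i≢i = contradiction refl i≢i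

  identity-≢ : ∀ {m} {i j : Fin m} → ¬ i ≡ j → identity F i j ≡ 0#
  identity-≢ {i = i} {j} i≢j with i Finₚ.≟ j
  ... | yes e = contradiction e i≢j
  ... | no _  = refl

  identity-sym : ∀ {m} (i j : Fin m) → identity F i j ≡ identity F j i
  identity-sym i j with i Finₚ.≟ j
  ... | yes refl = sym (identity-refl i)
  ... | no i≢j   = sym (identity-≢ (i≢j ∘ sym))

  -- Writing row i through three rows of the identity lets a product with a vector collapse to a
  -- local three-term expression.
  schrodinger-cycle : ∀ {n} d (i j : Fin (suc (suc (suc n)))) →
    schrodinger F (cycleAdj F _) d i j ≡
    lookup d i * identity F i j + identity F (next i) j + identity F (prev i) j
  schrodinger-cycle d i j with i Finₚ.≟ j
  ... | yes refl = begin
    cycleAdj F _ i i + lookup d i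
      ≡⟨ cong (_+ lookup d i) (cycleAdj-¬edge i i λ e → [ next≢i i , prev≢i i ]′ (edge⇒next⊎prev i i e)) ⟩
    0# + lookup d i
      ≡⟨ solve 1 (λ x → con ℤ.0ℤ :+ x := x :* con ℤ.1ℤ :+ con ℤ.0ℤ :+ con ℤ.0ℤ) refl (lookup d i) ⟩
    lookup d i * 1# + 0# + 0#
      ≡⟨ cong₂ (λ x y → lookup d i * 1# + x + y) (identity-≢ (next≢i i)) (identity-≢ (prev≢i i)) ⟨
    lookup d i * 1# + identity F (next i) i + identity F (prev i) i ∎
  ... | no i≢j with next i Finₚ.≟ j | prev i Finₚ.≟ j
  ...   | yes next≡j | yes prev≡j = contradiction (trans next≡j (sym prev≡j)) (next≢prev i)
  ...   | yes refl | no _ = trans (cycleAdj-edge i _ (edge-next i))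
            (solve 1 (λ x → con ℤ.1ℤ := x :* con ℤ.0ℤ :+ con ℤ.1ℤ :+ con ℤ.0ℤ) refl (lookup d i))
  ...   | no _ | yes refl = trans (cycleAdj-edge i _ (edge-prev i))
            (solve 1 (λ x → con ℤ.1ℤ := x :* con ℤ.0ℤ :+ con ℤ.0ℤ :+ con ℤ.1ℤ) refl (lookup d i))
  ...   | no next≢j | no prev≢j = trans (cycleAdj-¬edge i j λ e → [ next≢j , prev≢j ]′ (edge⇒next⊎prev i j e))
            (solve 1 (λ x → con ℤ.0ℤ := x :* con ℤ.0ℤ :+ con ℤ.0ℤ :+ con ℤ.0ℤ) refl (lookup d i))

  -- Finite sums and matrix products over the field.

  sumF≡sum : ∀ {m} (f : Fin m → Carrier) → sumF F f ≡ ∑F.sum f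
  sumF≡sum {zero}  f = refl
  sumF≡sum {suc m} f = cong (f zero +_) (sumF≡sum (f ∘ suc))

  sumF-cong : ∀ {m} {f g : Fin m → Carrier} → (∀ i → f i ≡ g i) → sumF F f ≡ sumF F g
  sumF-cong {zero}  eq = refl
  sumF-cong {suc m} eq = cong₂ _+_ (eq zero) (sumF-cong (eq ∘ suc))

  sumF-0 : ∀ {m} {f : Fin m → Carrier} → (∀ i → f i ≡ 0#) → sumF F f ≡ 0#
  sumF-0 {zero}  eq = refl
  sumF-0 {suc m} eq = trans (cong₂ _+_ (eq zero) (sumF-0 (eq ∘ suc))) (+-identityˡ 0#)

  sumF-+ : ∀ {m} (f g : Fin m → Carrier) → sumF F (λ i → f i + g i) ≡ sumF F f + sumF F g
  sumF-+ f g = trans (sumF≡sum (λ i → f i + g i)) (trans (∑F.∑-distrib-+ f g) (sym (cong₂ _+_ (sumF≡sum f) (sumF≡sum g))))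

  sumF-*ˡ : ∀ {m} c (f : Fin m → Carrier) → sumF F (λ i → c * f i) ≡ c * sumF F f
  sumF-*ˡ c f = trans (sumF≡sum (λ i → c * f i)) (trans (sym (∑F.*-distribˡ-sum c f)) (cong (c *_) (sym (sumF≡sum f))))

  sumF-comm : ∀ {m n} (f : Fin m → Fin n → Carrier) →
              sumF F (λ i → sumF F (f i)) ≡ sumF F (λ j → sumF F (λ i → f i j))
  sumF-comm f = begin
    sumF F (λ i → sumF F (f i))               ≡⟨ trans (sumF-cong (λ i → sumF≡sum (f i))) (sumF≡sum (λ i → ∑F.sum (f i))) ⟩
    ∑F.sum (λ i → ∑F.sum (f i))               ≡⟨ ∑F.∑-comm f ⟩
    ∑F.sum (λ j → ∑F.sum (λ i → f i j))       ≡⟨ trans (sumF-cong (λ j → sumF≡sum (λ i → f i j))) (sumF≡sum (λ j → ∑F.sum (λ i → f i j))) ⟨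
    sumF F (λ j → sumF F (λ i → f i j))       ∎

  product-assoc : ∀ {m n} (a : Fin m → Carrier) (B : Fin m → Fin n → Carrier) (c : Fin n → Carrier) →
    sumF F (λ k → a k * sumF F (λ l → B k l * c l)) ≡ sumF F (λ l → sumF F (λ k → a k * B k l) * c l)
  product-assoc a B c = begin
    sumF F (λ k → a k * sumF F (λ l → B k l * c l))      ≡⟨ sumF-cong (λ k → sym (sumF-*ˡ (a k) (λ l → B k l * c l))) ⟩
    sumF F (λ k → sumF F (λ l → a k * (B k l * c l)))    ≡⟨ sumF-comm (λ k l → a k * (B k l * c l)) ⟩
    sumF F (λ l → sumF F (λ k → a k * (B k l * c l)))    ≡⟨ sumF-cong (λ l → trans
      (sumF-cong λ k → solve 3 (λ a b c → a :* (b :* c) := c :* (a :* b)) refl (a k) (B k l) (c l))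
      (trans (sumF-*ˡ (c l) (λ k → a k * B k l)) (*-comm (c l) _))) ⟩
    sumF F (λ l → sumF F (λ k → a k * B k l) * c l)      ∎

  identity-product : ∀ {m} (i : Fin m) (x : Fin m → Carrier) → sumF F (λ j → identity F i j * x j) ≡ x i
  identity-product {suc m} zero x = begin
    identity F {suc m} zero zero * x zero + sumF F (λ j → identity F zero (suc j) * x (suc j))
      ≡⟨ cong₂ _+_ (*-identityˡ _) (sumF-0 (λ j → zeroˡ (x (suc j)))) ⟩
    x zero + 0#
      ≡⟨ +-identityʳ _ ⟩
    x zero ∎
  identity-product (suc i) x = begin
    identity F (suc i) zero * x zero + sumF F (λ j → identity F (suc i) (suc j) * x (suc j))
      ≡⟨ cong₂ _+_ (zeroˡ _) (sumF-cong (λ j → cong (_* x (suc j)) (identity-suc j))) ⟩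
    0# + sumF F (λ j → identity F i j * x (suc j))
      ≡⟨ trans (+-identityˡ _) (identity-product i (x ∘ suc)) ⟩
    x (suc i) ∎
    where
    identity-suc : ∀ j → identity F (suc i) (suc j) ≡ identity F i j
    identity-suc j with i Finₚ.≟ j
    ... | yes refl = refl
    ... | no i≢j   = refl

  schrodinger-cycle-product : ∀ {n} d (x : Fin (suc (suc (suc n))) → Carrier) i →
    sumF F (λ j → schrodinger F (cycleAdj F _) d i j * x j) ≡ lookup d i * x i + x (next i) + x (prev i)
  schrodinger-cycle-product d x i = begin
    sumF F (λ j → schrodinger F (cycleAdj F _) d i j * x j)
      ≡⟨ sumF-cong (λ j → trans (cong (_* x j) (schrodinger-cycle d i j))
           (solve 5 (λ d e₁ e₂ e₃ x → (d :* e₁ :+ e₂ :+ e₃) :* x := d :* (e₁ :* x) :+ e₂ :* x :+ e₃ :* x)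
             refl (lookup d i) (identity F i j) (identity F (next i) j) (identity F (prev i) j) (x j))) ⟩
    sumF F (λ j → lookup d i * (identity F i j * x j) + identity F (next i) j * x j + identity F (prev i) j * x j)
      ≡⟨ trans (sumF-+ (λ j → δᵢ j + δₙ j) δₚ) (cong (_+ sumF F δₚ) (sumF-+ δᵢ δₙ)) ⟩
    sumF F (λ j → lookup d i * (identity F i j * x j)) + sumF F (λ j → identity F (next i) j * x j)
      + sumF F (λ j → identity F (prev i) j * x j)
      ≡⟨ cong₂ _+_ (cong₂ _+_ (trans (sumF-*ˡ (lookup d i) (λ j → identity F i j * x j)) (cong (lookup d i *_) (identity-product i x)))
           (identity-product (next i) x)) (identity-product (prev i) x) ⟩
    lookup d i * x i + x (next i) + x (prev i) ∎
    where
    δᵢ δₙ δₚ : Fin _ → Carrier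
    δᵢ j = lookup d i * (identity F i j * x j)
    δₙ j = identity F (next i) j * x j
    δₚ j = identity F (prev i) j * x j

  -- Transposing M N = I gives Nᵀ M = I, as M is symmetric. A left and a right inverse agree, so Nᵀ
  -- = N and N is two-sided.
  symmetric-rightInverse⇒invertible : ∀ {m} (M N : Matrix F m) → (∀ i j → M i j ≡ M j i) →
    (∀ i j → (F ⊗ M) N i j ≡ identity F i j) → Invertible F M
  symmetric-rightInverse⇒invertible M N M-sym MN≡I = N , MN≡I , λ i j →
    trans (sumF-cong λ k → cong (_* M k j) (N-sym i k)) (NᵀM≡I i j)
    where
    NᵀM≡I : ∀ i j → sumF F (λ k → N k i * M k j) ≡ identity F i j
    NᵀM≡I i j = begin
      sumF F (λ k → N k i * M k j)  ≡⟨ sumF-cong (λ k → trans (*-comm _ _) (cong (_* N k i) (M-sym k j))) ⟩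
      sumF F (λ k → M j k * N k i)  ≡⟨ MN≡I j i ⟩
      identity F j i                ≡⟨ identity-sym j i ⟩
      identity F i j                ∎
    N-sym : ∀ i j → N i j ≡ N j i
    N-sym i j = begin
      N i j                                                   ≡⟨ identity-product i (λ l → N l j) ⟨
      sumF F (λ l → identity F i l * N l j)                   ≡⟨ sumF-cong (λ l → cong (_* N l j) (NᵀM≡I i l)) ⟨
      sumF F (λ l → sumF F (λ k → N k i * M k l) * N l j)     ≡⟨ product-assoc (λ k → N k i) M (λ l → N l j) ⟨
      sumF F (λ k → N k i * sumF F (λ l → M k l * N l j))     ≡⟨ sumF-cong (λ k → trans (cong (N k i *_) (trans (MN≡I k j) (identity-sym k j))) (*-comm _ _)) ⟩
      sumF F (λ k → identity F j k * N k i)                   ≡⟨ identity-product j (λ k → N k i) ⟩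
      N j i                                                   ∎

  invertible⇒kernel-0 : ∀ {m} (M : Matrix F m) → Invertible F M → ∀ x →
    (∀ i → sumF F (λ j → M i j * x j) ≡ 0#) → ∀ i → x i ≡ 0#
  invertible⇒kernel-0 M (N , _ , NM≡I) x Mx≡0 i = begin
    x i                                                     ≡⟨ identity-product i x ⟨
    sumF F (λ l → identity F i l * x l)                     ≡⟨ sumF-cong (λ l → cong (_* x l) (NM≡I i l)) ⟨
    sumF F (λ l → sumF F (λ k → N i k * M k l) * x l)       ≡⟨ product-assoc (N i) M x ⟨
    sumF F (λ k → N i k * sumF F (λ l → M k l * x l))       ≡⟨ sumF-0 (λ k → trans (cong (N i k *_) (Mx≡0 k)) (zeroʳ _)) ⟩
    0#                                                      ∎

  -- All intermediate pairs of an orbit: index 0 holds the final pair, the top index the starting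
  -- pair `p`.
  states : ∀ {m} → Vec Carrier m → Vec Carrier m → Point → Fin (suc m) → Point
  states bs       ds       p zero    = orbit bs ds p
  states (_ ∷ bs) (_ ∷ ds) p (suc i) = states bs ds p i

  states-step : ∀ {m} (b d : Vec Carrier m) p i →
    states b d p (inject₁ i) ≡ step (lookup b i) (lookup d i) (states b d p (suc i))
  states-step (_ ∷ _)  (_ ∷ _)  p zero    = refl
  states-step (_ ∷ bs) (_ ∷ ds) p (suc i) = states-step bs ds p i

  states-last : ∀ {m} (b d : Vec Carrier m) p → states b d p (fromℕ m) ≡ p
  states-last []       []       p = refl
  states-last (_ ∷ bs) (_ ∷ ds) p = states-last bs ds p

  -- The pair at index i + 1 is (xᵢ₊₁ , xᵢ). A fixed point makes the first and last pairs equal,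
  -- which closes the chain into a solution on the cycle.
  module Solution {n} (b d : Vec Carrier (suc n)) (p : Point) (fixed : orbit b d p ≡ p) where

    solution : Fin (suc n) → Carrier
    solution i = proj₂ (states b d p (suc i))

    solution-zero : solution zero ≡ proj₁ p
    solution-zero = trans (sym (cong proj₁ (states-step b d p zero))) (cong proj₁ fixed)

    solution-last : solution (fromℕ n) ≡ proj₂ p
    solution-last = cong proj₂ (states-last b d p)

    solution-next : ∀ i → solution (next i) ≡ proj₁ (states b d p (suc i))
    solution-next i with view i
    -- The successor of the last vertex is vertex 0, whose value is `proj₁ p` because `p` is fixed.
    ... | ‵fromℕ     = trans solution-zero (sym (cong proj₁ (states-last b d p)))
    ... | ‵inject₁ j = sym (cong proj₁ (states-step b d p (suc j)))

    solution-prev : ∀ i → solution (prev i) ≡ proj₂ (states b d p (inject₁ i))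
    solution-prev zero    = trans solution-last (sym (cong proj₂ fixed))
    solution-prev (suc j) = refl

    solution-equation : ∀ i → lookup d i * solution i + solution (next i) + solution (prev i) ≡ lookup b i
    solution-equation i = begin
      lookup d i * y + solution (next i) + solution (prev i)
        ≡⟨ cong₂ (λ s t → lookup d i * y + s + t) (solution-next i)
             (trans (solution-prev i) (cong proj₂ (states-step b d p i))) ⟩
      lookup d i * y + x + (lookup b i - (x + lookup d i * y))
        ≡⟨ solve 4 (λ d y x b → d :* y :+ x :+ (b :- (x :+ d :* y)) := b) refl (lookup d i) y x (lookup b i) ⟩
      lookup b i ∎
      where
      x = proj₁ (states b d p (suc i))
      y = proj₂ (states b d p (suc i))

  -- Solving with each unit vector as right-hand side gives the columns of a right inverse; symmetry
  -- makes it two-sided.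
  trace≢2⇒invertible : ∀ {n} (d : Vec Carrier (suc (suc (suc n)))) →
    ¬ trace d ≡ 1# + 1# → Invertible F (schrodinger F (cycleAdj F _) d)
  trace≢2⇒invertible d tr≢2 =
    symmetric-rightInverse⇒invertible (schrodinger F (cycleAdj F _) d) (λ i j → S.solution j i)
      (schrodinger-sym _ cycleAdj-sym d) λ i j →
        trans (schrodinger-cycle-product d (S.solution j) i)
          (trans (S.solution-equation j i) (Vecₚ.lookup∘tabulate (λ i → identity F i j) i))
    where
    column : Fin _ → Vec Carrier _
    column j = Vec.tabulate λ i → identity F i j
    module S (j : Fin _) = Solution (column j) d _ (proj₂ (orbit-fixed-point d tr≢2 (column j)))

  -- A fixed vector `p` of T yields a kernel vector whose values at vertex 0 and at the last vertex
  -- are the coordinates of `p`, so it cannot vanish.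
  trace≡2⇒¬invertible : ∀ {n} (d : Vec Carrier (suc (suc (suc n)))) →
    trace d ≡ 1# + 1# → ¬ Invertible F (schrodinger F (cycleAdj F _) d)
  trace≡2⇒¬invertible d tr≡2 inv with transfer-fixed-vector d tr≡2
  ... | p , p≢0 , fixed = p≢0 (cong₂ _,_
          (trans (sym solution-zero) (solution≡0 zero)) (trans (sym solution-last) (solution≡0 (fromℕ _))))
    where
    open Solution (Vec.replicate _ 0#) d p fixed
    solution≡0 : ∀ i → solution i ≡ 0#
    solution≡0 = invertible⇒kernel-0 (schrodinger F (cycleAdj F _) d) inv solution λ i →
      trans (schrodinger-cycle-product d solution i)
        (trans (solution-equation i) (Vecₚ.lookup-replicate i 0#))

  -- Kept as a sum to avoid truncated subtraction in ℕ.
  S-cycle+#trace=2 : (inv? : ∀ {m} (M : Matrix F m) → Dec (Invertible F M)) → ∀ n →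
    S-cycle F inv? (suc (suc (suc n))) ℕ.+ #trace=2 (suc (suc (suc n))) ≡ q ℕ.^ suc (suc (suc n))
  S-cycle+#trace=2 inv? n = begin
    S-cycle F inv? m ℕ.+ #trace=2 m
      ≡⟨ cong (ℕ._+ #trace=2 m) (length-filter-allVecs (λ d → inv? (schrodinger F (cycleAdj F m) d))) ⟩
    ∑V m (λ d → ind (inv? (schrodinger F (cycleAdj F m) d))) ℕ.+ #trace=2 m
      ≡⟨ ∑V-distrib-+ m (λ d → ind (inv? (schrodinger F (cycleAdj F m) d))) (λ d → ind (trace d ≟F (1# + 1#))) ⟨
    ∑V m (λ d → ind (inv? (schrodinger F (cycleAdj F m) d)) ℕ.+ ind (trace d ≟F (1# + 1#)))
      ≡⟨ ∑V-cong m exactly-one ⟩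
    ∑V m (λ _ → 1)
      ≡⟨ ∑V-1 m ⟩
    q ℕ.^ m ∎
    where
    m = suc (suc (suc n))
    exactly-one : ∀ d → ind (inv? (schrodinger F (cycleAdj F m) d)) ℕ.+ ind (trace d ≟F (1# + 1#)) ≡ 1
    exactly-one d with trace d ≟F (1# + 1#)
    ... | yes tr≡2 = cong (ℕ._+ 1) (ind-no (inv? _) (trace≡2⇒¬invertible d tr≡2))
    ... | no tr≢2  = cong (ℕ._+ 0) (ind-yes (inv? _) (trace≢2⇒invertible d tr≢2))

-- Solving the recurrences over the integers.

open import Data.Integer using (+_; 1ℤ; 0ℤ; _-_; _*_; _+_; _^_)

pos-^ : ∀ m n → + (m ℕ.^ n) ≡ (+ m) ^ n
pos-^ m zero    = refl
pos-^ m (suc n) = trans (ℤₚ.pos-* m (m ℕ.^ n)) (cong (+ m *_) (pos-^ m n))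

-- `L` counts the words with δ = 0, `P` and `N` those with (β , δ) = (1 , 0) and (-1 , 0). Closed
-- forms are multiplied by 1 + q or 1 - q² instead of divided.
module Recurrences (q : ℕ) (L P N : ℕ → ℕ)
  (L-zero : L 0 ≡ 0) (L-suc : ∀ m → L m ℕ.+ L (suc m) ≡ q ℕ.^ m)
  (P-zero : P 0 ≡ 0) (N-zero : N 0 ≡ 0)
  (P-suc-suc : ∀ m → P (suc (suc m)) ≡ L (suc m) ℕ.+ q ℕ.* N m)
  (N-suc-suc : ∀ m → N (suc (suc m)) ≡ L (suc m) ℕ.+ q ℕ.* P m)
  where

  open ≡-Reasoning

  Q : ℤ
  Q = + q

  pos-L-suc : ∀ m → + L (suc m) ≡ Q ^ m - + L m
  pos-L-suc m = begin
    + L (suc m)                      ≡⟨ cancel (+ L m) (+ L (suc m)) ⟨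
    (+ L m + + L (suc m)) - + L m    ≡⟨ cong (λ z → z - + L m) (trans (cong +_ (L-suc m)) (pos-^ q m)) ⟩
    Q ^ m - + L m                    ∎
    where
    cancel : ∀ x y → (x + y) - x ≡ y
    cancel = solve-∀

  pos-affine : ∀ {a b c} → a ≡ b ℕ.+ q ℕ.* c → + a ≡ + b + Q * + c
  pos-affine {b = b} {c} refl = cong (λ z → + b + z) (ℤₚ.pos-* q c)

  -- Both are the closed form (1 + Q) L(m) = Q^m - (-1)^m; the two parities feed each other through
  -- L(m) + L(m + 1) = q^m.
  L-even : ∀ n → (1ℤ + Q) * + L (n ℕ.* 2) ≡ Q ^ (n ℕ.* 2) - 1ℤ
  L-odd  : ∀ n → (1ℤ + Q) * + L (suc (n ℕ.* 2)) ≡ Q * Q ^ (n ℕ.* 2) + 1ℤ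

  L-even zero    = trans (cong (λ k → (1ℤ + Q) * + k) L-zero) (ℤₚ.*-zeroʳ (1ℤ + Q))
  L-even (suc n) = begin
    (1ℤ + Q) * + L (suc (suc (n ℕ.* 2)))                       ≡⟨ cong ((1ℤ + Q) *_) (pos-L-suc (suc (n ℕ.* 2))) ⟩
    (1ℤ + Q) * (Q * X - + L (suc (n ℕ.* 2)))                   ≡⟨ expand Q X _ ⟩
    (1ℤ + Q) * (Q * X) - (1ℤ + Q) * + L (suc (n ℕ.* 2))        ≡⟨ cong (λ z → (1ℤ + Q) * (Q * X) - z) (L-odd n) ⟩
    (1ℤ + Q) * (Q * X) - (Q * X + 1ℤ)                          ≡⟨ collect Q X ⟩
    Q * (Q * X) - 1ℤ                                           ∎
    where
    X = Q ^ (n ℕ.* 2)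
    expand : ∀ Q X l → (1ℤ + Q) * (Q * X - l) ≡ (1ℤ + Q) * (Q * X) - (1ℤ + Q) * l
    expand = solve-∀
    collect : ∀ Q X → (1ℤ + Q) * (Q * X) - (Q * X + 1ℤ) ≡ Q * (Q * X) - 1ℤ
    collect = solve-∀

  L-odd n = begin
    (1ℤ + Q) * + L (suc (n ℕ.* 2))                 ≡⟨ cong ((1ℤ + Q) *_) (pos-L-suc (n ℕ.* 2)) ⟩
    (1ℤ + Q) * (X - + L (n ℕ.* 2))                 ≡⟨ expand Q X _ ⟩
    (1ℤ + Q) * X - (1ℤ + Q) * + L (n ℕ.* 2)        ≡⟨ cong (λ z → (1ℤ + Q) * X - z) (L-even n) ⟩
    (1ℤ + Q) * X - (X - 1ℤ)                        ≡⟨ collect Q X ⟩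
    Q * X + 1ℤ                                     ∎
    where
    X = Q ^ (n ℕ.* 2)
    expand : ∀ Q X l → (1ℤ + Q) * (X - l) ≡ (1ℤ + Q) * X - (1ℤ + Q) * l
    expand = solve-∀
    collect : ∀ Q X → (1ℤ + Q) * X - (X - 1ℤ) ≡ Q * X + 1ℤ
    collect = solve-∀

  -- Factoring 1 - Q² = (1 - Q)(1 + Q) exposes the multiples of `l` and `a` whose values are known.
  expand-affine : ∀ Q l a → (1ℤ - Q ^ 2) * (l + Q * a) ≡ (1ℤ - Q) * ((1ℤ + Q) * l) + Q * ((1ℤ - Q ^ 2) * a)
  expand-affine Q l a = trans (cong (λ z → (1ℤ - z) * (l + Q * a)) (square Q))
    (trans (ring Q l a) (cong (λ z → (1ℤ - Q) * ((1ℤ + Q) * l) + Q * ((1ℤ - z) * a)) (sym (square Q))))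
    where
    square : ∀ Q → Q ^ 2 ≡ Q * Q
    square Q = cong (Q *_) (ℤₚ.*-identityʳ Q)
    ring : ∀ Q l a → (1ℤ - Q * Q) * (l + Q * a) ≡ (1ℤ - Q) * ((1ℤ + Q) * l) + Q * ((1ℤ - Q * Q) * a)
    ring = solve-∀

  -- Used both for the induction on `P` and `N` at even lengths and for the trace count at odd
  -- lengths.
  odd-step : ∀ n {a b} → (1ℤ - Q ^ 2) * + a ≡ 1ℤ - Q ^ (n ℕ.* 2) → b ≡ L (suc (n ℕ.* 2)) ℕ.+ q ℕ.* a →
             (1ℤ - Q ^ 2) * + b ≡ 1ℤ - Q ^ (suc n ℕ.* 2)
  odd-step n {a} {b} a-value b≡ = begin
    (1ℤ - Q ^ 2) * + b
      ≡⟨ cong ((1ℤ - Q ^ 2) *_) (pos-affine b≡) ⟩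
    (1ℤ - Q ^ 2) * (l + Q * + a)
      ≡⟨ expand-affine Q l (+ a) ⟩
    (1ℤ - Q) * ((1ℤ + Q) * l) + Q * ((1ℤ - Q ^ 2) * + a)
      ≡⟨ cong₂ (λ y z → (1ℤ - Q) * y + Q * z) (L-odd n) a-value ⟩
    (1ℤ - Q) * (Q * X + 1ℤ) + Q * (1ℤ - X)
      ≡⟨ collect Q X ⟩
    1ℤ - Q * (Q * X) ∎
    where
    l = + L (suc (n ℕ.* 2))
    X = Q ^ (n ℕ.* 2)
    collect : ∀ Q X → (1ℤ - Q) * (Q * X + 1ℤ) + Q * (1ℤ - X) ≡ 1ℤ - Q * (Q * X)
    collect = solve-∀

  -- Both sequences start at 0, so the exchange of signs is invisible at even lengths. This is why
  -- odd cycles need no case distinction on q.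
  P,N-even : ∀ n → (1ℤ - Q ^ 2) * + P (n ℕ.* 2) ≡ 1ℤ - Q ^ (n ℕ.* 2) ×
                   (1ℤ - Q ^ 2) * + N (n ℕ.* 2) ≡ 1ℤ - Q ^ (n ℕ.* 2)
  P,N-even zero    = trans (cong (λ k → (1ℤ - Q ^ 2) * + k) P-zero) (ℤₚ.*-zeroʳ (1ℤ - Q ^ 2)) ,
                     trans (cong (λ k → (1ℤ - Q ^ 2) * + k) N-zero) (ℤₚ.*-zeroʳ (1ℤ - Q ^ 2))
  P,N-even (suc n) = odd-step n (proj₂ (P,N-even n)) (P-suc-suc (n ℕ.* 2)) ,
                     odd-step n (proj₁ (P,N-even n)) (N-suc-suc (n ℕ.* 2))

  -- The parameter ε is the value of the sequence at n = 0, where the product on the right vanishes.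
  EvenValue : ℤ → ℕ → ℕ → Set
  EvenValue ε n a = (1ℤ - Q ^ 2) * + a ≡ (1ℤ - Q ^ 2) * (ε * Q ^ n) - (1ℤ - Q ^ n) * (1ℤ - Q ^ suc n)

  -- The counterpart of `odd-step`: it advances `P` and `N` at odd lengths and evaluates the trace
  -- count at even lengths, leaving ε unchanged.
  even-step : ∀ ε n {a b} → EvenValue ε n a → b ≡ L (suc n ℕ.* 2) ℕ.+ q ℕ.* a → EvenValue ε (suc n) b
  even-step ε n {a} {b} a-value b≡ = begin
    (1ℤ - Q ^ 2) * + b
      ≡⟨ cong ((1ℤ - Q ^ 2) *_) (pos-affine b≡) ⟩
    (1ℤ - Q ^ 2) * (l + Q * + a)
      ≡⟨ expand-affine Q l (+ a) ⟩
    (1ℤ - Q) * ((1ℤ + Q) * l) + Q * ((1ℤ - Q ^ 2) * + a)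
      ≡⟨ cong₂ (λ y z → (1ℤ - Q) * y + Q * z)
           (trans (L-even (suc n)) (cong (λ z → Q * (Q * z) - 1ℤ) square)) a-value ⟩
    (1ℤ - Q) * (Q * (Q * (Y * Y)) - 1ℤ) + Q * ((1ℤ - Q ^ 2) * (ε * Y) - (1ℤ - Y) * (1ℤ - Q * Y))
      ≡⟨ collect (1ℤ - Q ^ 2) ε Q Y ⟩
    (1ℤ - Q ^ 2) * (ε * (Q * Y)) - (1ℤ - Q * Y) * (1ℤ - Q * (Q * Y)) ∎
    where
    l = + L (suc n ℕ.* 2)
    Y = Q ^ n
    square : Q ^ (n ℕ.* 2) ≡ Y * Y
    square = trans (sym (ℤₚ.^-*-assoc Q n 2)) (cong (Y *_) (ℤₚ.*-identityʳ Y))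
    collect : ∀ D ε Q Y → (1ℤ - Q) * (Q * (Q * (Y * Y)) - 1ℤ) + Q * (D * (ε * Y) - (1ℤ - Y) * (1ℤ - Q * Y))
                        ≡ D * (ε * (Q * Y)) - (1ℤ - Q * Y) * (1ℤ - Q * (Q * Y))
    collect = solve-∀

  -- Each recurrence refers to the other sequence, so the two parameters change places.
  P,N-odd-suc : ∀ ε ε′ n → EvenValue ε n (P (suc (n ℕ.* 2))) × EvenValue ε′ n (N (suc (n ℕ.* 2))) →
    EvenValue ε′ (suc n) (P (suc (suc n ℕ.* 2))) × EvenValue ε (suc n) (N (suc (suc n ℕ.* 2)))
  P,N-odd-suc ε ε′ n (P-value , N-value) =
    even-step ε′ n N-value (P-suc-suc (suc (n ℕ.* 2))) , even-step ε n P-value (N-suc-suc (suc (n ℕ.* 2)))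

  evenValue-zero-1 : ∀ {a} → a ≡ 1 → EvenValue 1ℤ 0 a
  evenValue-zero-1 refl = ring Q (1ℤ - Q ^ 2)
    where
    ring : ∀ Q D → D * 1ℤ ≡ D * (1ℤ * 1ℤ) - (1ℤ - 1ℤ) * (1ℤ - Q * 1ℤ)
    ring = solve-∀

  evenValue-zero-0 : ∀ {a} → a ≡ 0 → EvenValue 0ℤ 0 a
  evenValue-zero-0 refl = ring Q (1ℤ - Q ^ 2)
    where
    ring : ∀ Q D → D * 0ℤ ≡ D * (0ℤ * 1ℤ) - (1ℤ - 1ℤ) * (1ℤ - Q * 1ℤ)
    ring = solve-∀

  module Equal (P-one : P 1 ≡ 1) (N-one : N 1 ≡ 1) where
    P,N-odd : ∀ n → EvenValue 1ℤ n (P (suc (n ℕ.* 2))) × EvenValue 1ℤ n (N (suc (n ℕ.* 2)))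
    P,N-odd zero    = evenValue-zero-1 P-one , evenValue-zero-1 N-one
    P,N-odd (suc n) = P,N-odd-suc 1ℤ 1ℤ n (P,N-odd n)

  module Distinct (P-one : P 1 ≡ 1) (N-one : N 1 ≡ 0) where
    P,N-odd : ∀ n → EvenValue 1ℤ (n ℕ.* 2) (P (suc ((n ℕ.* 2) ℕ.* 2))) × EvenValue 0ℤ (n ℕ.* 2) (N (suc ((n ℕ.* 2) ℕ.* 2)))
    P,N-odd zero    = evenValue-zero-1 P-one , evenValue-zero-0 N-one
    -- Two exchanges restore the parameters, hence the advance by four letters.
    P,N-odd (suc n) = P,N-odd-suc 0ℤ 1ℤ (suc (n ℕ.* 2)) (P,N-odd-suc 1ℤ 0ℤ (n ℕ.* 2) (P,N-odd n))

-- The formulas for the number of invertible operators.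

module CycleCount {q : ℕ} (F : FiniteField q) (inv? : ∀ {m} (M : Matrix F m) → Dec (Invertible F M)) where
  open Counting F using (ringF; 1+1≡0⇒2∣q; 2∣q⇒1+1≡0)
  open Monodromy F
  open Cycle F using (S-cycle+#trace=2)
  open FiniteField F using (0≢1; _≟F_)
  open CommutativeRing ringF using (0#; 1#; -‿inverseʳ; +-identityʳ) renaming (-_ to -F_; _+_ to _+F_)
  open AbelianGroupProperties (CommutativeRing.+-abelianGroup ringF) using (⁻¹-involutive; inverseʳ-unique)
  open ≡-Reasoning

  -1≢0 : ¬ -F 1# ≡ 0#
  -1≢0 -1≡0 = 0≢1 (begin
    0#             ≡⟨ -‿inverseʳ 1# ⟨
    1# +F (-F 1#)  ≡⟨ cong (1# +F_) -1≡0 ⟩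
    1# +F 0#       ≡⟨ +-identityʳ 1# ⟩
    1#             ∎)

  open Recurrences q (λ m → #δ= m 0#) (#βδ 1#) (#βδ (-F 1#))
    #δ=0-zero
    (λ m → trans (cong (#δ= m 0# ℕ.+_) (#δ=0-suc m)) (#δ=0+#δ≢0 m))
    (#βδ-zero 1#) (#βδ-zero (-F 1#))
    (λ m → #βδ-suc-suc m 1# (0≢1 ∘ sym))
    -- Rewriting -(-1) as 1 closes the system of the two signs.
    (λ m → trans (#βδ-suc-suc m (-F 1#) -1≢0) (cong (λ c → #δ= (suc m) 0# ℕ.+ q ℕ.* #βδ c m) (⁻¹-involutive 1#)))

  #βδ1-one : #βδ 1# 1 ≡ 1
  #βδ1-one = trans (#βδ-one 1# (0≢1 ∘ sym)) (ind-yes (1# ≟F 1#) refl)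

  S : ℕ → ℕ
  S = S-cycle F inv?

  S-value : ∀ n → n ≥ 3 → (1ℤ - Q ^ 2) * + S n ≡ (1ℤ - Q ^ 2) * Q ^ n - (1ℤ - Q ^ 2) * + #trace=2 n
  S-value (suc (suc (suc n))) (s≤s (s≤s (s≤s _))) = begin
    (1ℤ - Q ^ 2) * + S m                                        ≡⟨ ring (1ℤ - Q ^ 2) (+ S m) (+ #trace=2 m) ⟩
    (1ℤ - Q ^ 2) * (+ S m + + #trace=2 m) - (1ℤ - Q ^ 2) * + #trace=2 m
      ≡⟨ cong (λ z → (1ℤ - Q ^ 2) * z - (1ℤ - Q ^ 2) * + #trace=2 m) (trans (cong +_ (S-cycle+#trace=2 inv? n)) (pos-^ q m)) ⟩
    (1ℤ - Q ^ 2) * Q ^ m - (1ℤ - Q ^ 2) * + #trace=2 m          ∎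
    where
    m = suc (suc (suc n))
    ring : ∀ D s t → D * s ≡ D * (s + t) - D * t
    ring = solve-∀

  S-odd : ∀ n → n ≥ 1 →
    (1ℤ - Q ^ 2) * + S (2 ℕ.* n ℕ.+ 1) ≡ (1ℤ - Q ^ 2) * Q ^ (2 ℕ.* n ℕ.+ 1) - (1ℤ - Q ^ (2 ℕ.* n ℕ.+ 2))
  -- The recurrences use lengths of the form `n * 2`, which unfold two successors at a time; the
  -- result is transported to the stated exponents.
  S-odd n@(suc k) _ = subst₂
    (λ m m′ → (1ℤ - Q ^ 2) * + S m ≡ (1ℤ - Q ^ 2) * Q ^ m - (1ℤ - Q ^ m′))
    (trans (ℕₚ.+-comm 1 (n ℕ.* 2)) (cong (ℕ._+ 1) (ℕₚ.*-comm n 2)))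
    (trans (ℕₚ.+-comm 2 (n ℕ.* 2)) (cong (ℕ._+ 2) (ℕₚ.*-comm n 2)))
    (trans (S-value (suc (n ℕ.* 2)) (s≤s (s≤s (s≤s ℕ.z≤n))))
      (cong (λ z → (1ℤ - Q ^ 2) * Q ^ suc (n ℕ.* 2) - z)
        (odd-step n (proj₂ (P,N-even n)) (#trace=2-suc (n ℕ.* 2)))))

  -- The parameter ε of the count for -1, taken one letter before the full length, decides whether
  -- the middle term Q^(n + 2) appears.
  S-even : ∀ ε n → EvenValue ε (suc n) (#βδ (-F 1#) (suc (suc n ℕ.* 2))) →
    (1ℤ - Q ^ 2) * + S (suc (suc n) ℕ.* 2) ≡
    (1ℤ - Q ^ 2) * (Q ^ (suc (suc n) ℕ.* 2) - ε * Q ^ suc (suc n)) + (1ℤ - Q ^ suc (suc n)) * (1ℤ - Q ^ suc (suc (suc n)))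
  S-even ε n value = begin
    (1ℤ - Q ^ 2) * + S m
      ≡⟨ S-value m (s≤s (s≤s (s≤s ℕ.z≤n))) ⟩
    (1ℤ - Q ^ 2) * Q ^ m - (1ℤ - Q ^ 2) * + #trace=2 m
      ≡⟨ cong (λ z → (1ℤ - Q ^ 2) * Q ^ m - z) (even-step ε (suc n) value (#trace=2-suc (suc (suc n ℕ.* 2)))) ⟩
    (1ℤ - Q ^ 2) * Q ^ m - ((1ℤ - Q ^ 2) * (ε * Y) - (1ℤ - Y) * (1ℤ - Q * Y))
      ≡⟨ ring (1ℤ - Q ^ 2) (Q ^ m) (ε * Y) ((1ℤ - Y) * (1ℤ - Q * Y)) ⟩
    (1ℤ - Q ^ 2) * (Q ^ m - ε * Y) + (1ℤ - Y) * (1ℤ - Q * Y) ∎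
    where
    m = suc (suc n) ℕ.* 2
    Y = Q ^ suc (suc n)
    ring : ∀ D x y z → D * x - (D * y - z) ≡ D * (x - y) + z
    ring = solve-∀

  S-even-1 : ∀ n → EvenValue 1ℤ (suc n) (#βδ (-F 1#) (suc (suc n ℕ.* 2))) →
    (1ℤ - Q ^ 2) * + S (suc (suc n) ℕ.* 2) ≡
    (1ℤ - Q ^ 2) * (Q ^ (suc (suc n) ℕ.* 2) - Q ^ suc (suc n)) + (1ℤ - Q ^ suc (suc n)) * (1ℤ - Q ^ suc (suc (suc n)))
  S-even-1 n value = trans (S-even 1ℤ n value)
    (cong (λ z → (1ℤ - Q ^ 2) * (Q ^ (suc (suc n) ℕ.* 2) - z) + (1ℤ - Q ^ suc (suc n)) * (1ℤ - Q ^ suc (suc (suc n))))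
      (ℤₚ.*-identityˡ (Q ^ suc (suc n))))

  S-even-0 : ∀ n → EvenValue 0ℤ (suc n) (#βδ (-F 1#) (suc (suc n ℕ.* 2))) →
    (1ℤ - Q ^ 2) * + S (suc (suc n) ℕ.* 2) ≡
    (1ℤ - Q ^ 2) * Q ^ (suc (suc n) ℕ.* 2) + (1ℤ - Q ^ suc (suc n)) * (1ℤ - Q ^ suc (suc (suc n)))
  S-even-0 n value = trans (S-even 0ℤ n value)
    (cong (λ z → (1ℤ - Q ^ 2) * z + (1ℤ - Q ^ suc (suc n)) * (1ℤ - Q ^ suc (suc (suc n))))
      (trans (cong (λ z → Q ^ (suc (suc n) ℕ.* 2) - z) (ℤₚ.*-zeroˡ (Q ^ suc (suc n)))) (ℤₚ.+-identityʳ _)))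

  4*n≡n*2*2 : ∀ n → 4 ℕ.* n ≡ (n ℕ.* 2) ℕ.* 2
  4*n≡n*2*2 n = trans (ℕₚ.*-comm 4 n) (sym (ℕₚ.*-assoc n 2 2))

  module OddCharacteristic (2∤q : ¬ 2 ∣ q) where
    1≢-1 : ¬ 1# ≡ -F 1#
    1≢-1 1≡-1 = 2∤q (1+1≡0⇒2∣q (trans (cong (1# +F_) 1≡-1) (-‿inverseʳ 1#)))

    open Distinct #βδ1-one (trans (#βδ-one (-F 1#) -1≢0) (ind-no (1# ≟F (-F 1#)) 1≢-1))

    S-4n : ∀ n → n ≥ 1 → (1ℤ - Q ^ 2) * + S (4 ℕ.* n) ≡
      (1ℤ - Q ^ 2) * (Q ^ (4 ℕ.* n) - Q ^ (2 ℕ.* n)) + (1ℤ - Q ^ (2 ℕ.* n)) * (1ℤ - Q ^ (2 ℕ.* n ℕ.+ 1))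
    S-4n n@(suc k) _ = formula (4*n≡n*2*2 n) (ℕₚ.*-comm 2 n) (trans (cong (ℕ._+ 1) (ℕₚ.*-comm 2 n)) (ℕₚ.+-comm (n ℕ.* 2) 1))
      where
      formula : ∀ {m e e′} → m ≡ (n ℕ.* 2) ℕ.* 2 → e ≡ n ℕ.* 2 → e′ ≡ suc (n ℕ.* 2) →
        (1ℤ - Q ^ 2) * + S m ≡ (1ℤ - Q ^ 2) * (Q ^ m - Q ^ e) + (1ℤ - Q ^ e) * (1ℤ - Q ^ e′)
      -- `P,N-odd k` concerns length 4k + 1. One exchange leads to 4k + 3 = 4n - 1, where the count
      -- for -1 carries the parameter 1.
      formula refl refl refl = S-even-1 (k ℕ.* 2) (proj₂ (P,N-odd-suc 1ℤ 0ℤ (k ℕ.* 2) (P,N-odd k)))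

    S-4n+2 : ∀ n → n ≥ 1 → (1ℤ - Q ^ 2) * + S (4 ℕ.* n ℕ.+ 2) ≡
      (1ℤ - Q ^ 2) * Q ^ (4 ℕ.* n ℕ.+ 2) + (1ℤ - Q ^ (2 ℕ.* n ℕ.+ 1)) * (1ℤ - Q ^ (2 ℕ.* n ℕ.+ 2))
    S-4n+2 n@(suc k) _ = formula
      (trans (cong (ℕ._+ 2) (4*n≡n*2*2 n)) (ℕₚ.+-comm _ 2))
      (trans (cong (ℕ._+ 1) (ℕₚ.*-comm 2 n)) (ℕₚ.+-comm (n ℕ.* 2) 1))
      (trans (cong (ℕ._+ 2) (ℕₚ.*-comm 2 n)) (ℕₚ.+-comm (n ℕ.* 2) 2))
      where
      formula : ∀ {m e e′} → m ≡ suc (n ℕ.* 2) ℕ.* 2 → e ≡ suc (n ℕ.* 2) → e′ ≡ suc (suc (n ℕ.* 2)) →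
        (1ℤ - Q ^ 2) * + S m ≡ (1ℤ - Q ^ 2) * Q ^ m + (1ℤ - Q ^ e) * (1ℤ - Q ^ e′)
      -- At length 4n + 1 the parameters are back in place: the count for -1 carries 0, and the
      -- middle term disappears.
      formula refl refl refl = S-even-0 (suc (k ℕ.* 2)) (proj₂ (P,N-odd n))

  module EvenCharacteristic (2∣q : 2 ∣ q) where
    1≡-1 : 1# ≡ -F 1#
    1≡-1 = inverseʳ-unique 1# 1# (2∣q⇒1+1≡0 2∣q)

    open Equal #βδ1-one (trans (#βδ-one (-F 1#) -1≢0) (ind-yes (1# ≟F (-F 1#)) 1≡-1))

    S-2n : ∀ n → n ≥ 2 → (1ℤ - Q ^ 2) * + S (2 ℕ.* n) ≡
      (1ℤ - Q ^ 2) * (Q ^ (2 ℕ.* n) - Q ^ n) + (1ℤ - Q ^ n) * (1ℤ - Q ^ (n ℕ.+ 1))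
    S-2n n@(suc (suc k)) _ = formula (ℕₚ.*-comm 2 n) (ℕₚ.+-comm n 1)
      where
      formula : ∀ {m e′} → m ≡ n ℕ.* 2 → e′ ≡ suc n →
        (1ℤ - Q ^ 2) * + S m ≡ (1ℤ - Q ^ 2) * (Q ^ m - Q ^ n) + (1ℤ - Q ^ n) * (1ℤ - Q ^ e′)
      -- As 1 = -1, both counts carry the parameter 1 at every odd length.
      formula refl refl = S-even-1 k (proj₂ (P,N-odd (suc k)))
    S-2n (suc zero) (s≤s ())

theorem2 : ∀ {q : ℕ} (F : FiniteField q)
    (inv? : ∀ {m} (M : Matrix F m) → Dec (Invertible F M)) →
    (¬ (2 ∣ q) → ∀ (n : ℕ) → n ≥ 1 →
    ((1ℤ - (+ q) ^ 2) * (+ S-cycle F inv? (2 Data.Nat.* n Data.Nat.+ 1))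
    ≡ (1ℤ - (+ q) ^ 2) * (+ q) ^ (2 Data.Nat.* n Data.Nat.+ 1)
    - (1ℤ - (+ q) ^ (2 Data.Nat.* n Data.Nat.+ 2)))
    × ((1ℤ - (+ q) ^ 2) * (+ S-cycle F inv? (4 Data.Nat.* n))
    ≡ (1ℤ - (+ q) ^ 2) * ((+ q) ^ (4 Data.Nat.* n) - (+ q) ^ (2 Data.Nat.* n))
    + (1ℤ - (+ q) ^ (2 Data.Nat.* n)) * (1ℤ - (+ q) ^ (2 Data.Nat.* n Data.Nat.+ 1)))
    × ((1ℤ - (+ q) ^ 2) * (+ S-cycle F inv? (4 Data.Nat.* n Data.Nat.+ 2))
    ≡ (1ℤ - (+ q) ^ 2) * (+ q) ^ (4 Data.Nat.* n Data.Nat.+ 2)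
    + (1ℤ - (+ q) ^ (2 Data.Nat.* n Data.Nat.+ 1)) * (1ℤ - (+ q) ^ (2 Data.Nat.* n Data.Nat.+ 2))))
    × (2 ∣ q →
    (∀ (n : ℕ) → n ≥ 1 →
    (1ℤ - (+ q) ^ 2) * (+ S-cycle F inv? (2 Data.Nat.* n Data.Nat.+ 1))
    ≡ (1ℤ - (+ q) ^ 2) * (+ q) ^ (2 Data.Nat.* n Data.Nat.+ 1)
    - (1ℤ - (+ q) ^ (2 Data.Nat.* n Data.Nat.+ 2)))
    × (∀ (n : ℕ) → n ≥ 2 →
    (1ℤ - (+ q) ^ 2) * (+ S-cycle F inv? (2 Data.Nat.* n))
    ≡ (1ℤ - (+ q) ^ 2) * ((+ q) ^ (2 Data.Nat.* n) - (+ q) ^ n)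
    + (1ℤ - (+ q) ^ n) * (1ℤ - (+ q) ^ (n Data.Nat.+ 1))))
theorem2 F inv? =
    (λ 2∤q n n≥1 → S-odd n n≥1 , OddCharacteristic.S-4n 2∤q n n≥1 , OddCharacteristic.S-4n+2 2∤q n n≥1)
  , (λ 2∣q → S-odd , EvenCharacteristic.S-2n 2∣q)
  where open CycleCount F inv?
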